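{- Let $\mathbf{k}$ be a commutative ring, $V$ a set with $n$ elements, and for each $a\in V\times V$ let $t_a\in\mathbf{k}$ and $s_a:=t_a+1$. Then \[\widetilde{U}_t=\sum_{\sigma\in\mathfrak{S}_V}\left(\prod_{\gamma\text{ a cycle of }\sigma}\Bigl(\prod_{a\in\operatorname{CArcs}\gamma}s_a-\prod_{a\in\operatorname{CArcs}\gamma}t_a\Bigr)\right)p_{\operatorname{type}\sigma}.\]
   Context: A $V$-listing is a tuple $w=(w_1,\dots,w_n)$ containing each element of $V$ exactly once. The deformed Redei--Berge symmetric function is $\widetilde{U}_t=\sum_{w}\sum_{i_1\le i_2\le\cdots\le i_n}\Bigl(\prod_{k\in[n-1],\,i_k=i_{k+1}}s_{(w_k,w_{k+1})}\Bigr)x_{i_1}x_{i_2}\cdots x_{i_n}\in\mathbf{k}[[x_1,x_2,\dots]]$, where $w$ ranges over $V$-listings and $i_1,\dots,i_n$ over positive integers. The cycles of $\sigma\in\mathfrak{S}_V$ are the rotation-equivalence classes (under cyclic rotation) of tuples $(i,\sigma(i),\dots,\sigma^{k-1}(i))$ with $k$ minimal such that $\sigma^k(i)=i$ (including cycles of length $1$); for the class $\gamma$ of $(v_1,\dots,v_k)$, $\operatorname{CArcs}\gamma=\{(v_1,v_2),\dots,(v_{k-1},v_k),(v_k,v_1)\}$. $\operatorname{type}\sigma$ is the partition of cycle lengths of $\sigma$; $p_m=x_1^m+x_2^m+\cdots$, $p_\lambda=\prod_j p_{\lambda_j}$. -}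

module Defs where

open import Level using (Level)
open import Algebra.Bundles using (CommutativeRing)
open import Data.Nat as ℕ using (ℕ; zero; suc)
open import Data.Fin as F using (Fin)
open import Data.Vec as V using (Vec; []; _∷_)
open import Data.Vec.Properties as VP using ()
open import Data.List as L using (List; []; _∷_)
open import Data.Bool.ListAction using (any; all)
open import Data.Bool using (Bool; true; false; if_then_else_; not; _∧_)
open import Data.Product using (_×_; _,_)
open import Relation.Nullary.Decidable using (⌊_⌋)

allVecs : {A : Set} → List A → (m : ℕ) → List (Vec A m)
allVecs xs zero    = [] ∷ []
allVecs xs (suc m) = L.concatMap (λ x → L.map (x ∷_) (allVecs xs m)) xs

distinct : ∀ {n m} → Vec (Fin n) m → Bool
distinct []       = true
distinct (x ∷ xs) = not (any (λ y → ⌊ x F.≟ y ⌋) (V.toList xs)) ∧ distinct xs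

-- V = Fin n.  The V-listings (tuples containing each element exactly once).
listings : (n : ℕ) → List (Vec (Fin n) n)
listings n = L.filterᵇ distinct (allVecs (L.allFin n) n)

-- The symmetric group S_V, a permutation σ given by its table (σ 0, …, σ (n-1)).
perms : (n : ℕ) → List (Fin n → Fin n)
perms n = L.map (λ w i → V.lookup w i) (listings n)

weakInc : ∀ {N m} → Vec (Fin N) m → Bool
weakInc []               = true
weakInc (x ∷ [])         = true
weakInc (x ∷ y ∷ xs)     = ⌊ x F.≤? y ⌋ ∧ weakInc (y ∷ xs)

-- exponent vector of the monomial x_{i₁} ⋯ x_{i_m}
expo : ∀ {N m} → Vec (Fin N) m → Vec ℕ N
expo {N} i = V.tabulate (λ j → L.length (L.filterᵇ (λ x → ⌊ x F.≟ j ⌋) (V.toList i)))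

σpow : ∀ {n} → (Fin n → Fin n) → ℕ → Fin n → Fin n
σpow σ zero    i = i
σpow σ (suc k) i = σ (σpow σ k i)

headOr : {A : Set} → A → List A → A
headOr d []      = d
headOr d (x ∷ _) = x

retLen : ∀ {n} → (Fin n → Fin n) → Fin n → ℕ
retLen {n} σ i = headOr n (L.filterᵇ (λ k → ⌊ σpow σ k i F.≟ i ⌋) (L.map suc (L.upTo n)))

orbit : ∀ {n} → (Fin n → Fin n) → Fin n → List (Fin n)
orbit σ i = L.map (λ j → σpow σ j i) (L.upTo (retLen σ i))

-- i is the least element of its cycle (chosen representative of the rotation class)
isRep : ∀ {n} → (Fin n → Fin n) → Fin n → Bool
isRep σ i = all (λ v → ⌊ i F.≤? v ⌋) (orbit σ i)

cycles : ∀ {n} → (Fin n → Fin n) → List (List (Fin n))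
cycles {n} σ = L.map (orbit σ) (L.filterᵇ (isRep σ) (L.allFin n))

CArcs : ∀ {n} → List (Fin n) → List (Fin n × Fin n)
CArcs []       = []
CArcs (v ∷ vs) = L.zip (v ∷ vs) (vs L.++ (v ∷ []))

-- type σ (list of cycle lengths; order irrelevant as p_λ is a product)
type : ∀ {n} → (Fin n → Fin n) → List ℕ
type σ = L.map L.length (cycles σ)

-- Polynomials over k in N variables x₁,…,x_N (coefficient functions)

module _ {c ℓ} (R : CommutativeRing c ℓ) where
  open CommutativeRing R

  Poly : ℕ → Set c
  Poly N = Vec ℕ N → Carrier

  _≈ₚ_ : ∀ {N} → Poly N → Poly N → Set ℓ
  f ≈ₚ g = ∀ α → f α ≈ g α

  mono : ∀ {N} → Vec ℕ N → Poly N
  mono α β = if ⌊ VP.≡-dec ℕ._≟_ α β ⌋ then 1# else 0#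

  _⊕_ : ∀ {N} → Poly N → Poly N → Poly N
  (f ⊕ g) α = f α + g α

  _•_ : ∀ {N} → Carrier → Poly N → Poly N
  (a • f) α = a * f α

  sumP : ∀ {N} → List (Poly N) → Poly N
  sumP = L.foldr _⊕_ (λ _ → 0#)

  below : ∀ {N} → Vec ℕ N → List (Vec ℕ N)
  below []      = [] ∷ []
  below (a ∷ α) = L.concatMap (λ b → L.map (b ∷_) (below α)) (L.upTo (suc a))

  _⊗_ : ∀ {N} → Poly N → Poly N → Poly N
  (f ⊗ g) α = L.foldr _+_ 0# (L.map (λ β → f β * g (V.zipWith ℕ._∸_ α β)) (below α))

  prodP : ∀ {N} → List (Poly N) → Poly N
  prodP {N} = L.foldr _⊗_ (mono (V.replicate N 0))

  prodR : List Carrier → Carrier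
  prodR = L.foldr _*_ 1#

  pw : (N : ℕ) → ℕ → Poly N
  pw N m = sumP (L.map (λ j → mono (V.tabulate (λ j' → if ⌊ j F.≟ j' ⌋ then m else 0))) (L.allFin N))

  pλ : (N : ℕ) → List ℕ → Poly N
  pλ N λs = prodP (L.map (pw N) λs)

  module _ (n : ℕ) (t : Fin n → Fin n → Carrier) where
    s : Fin n → Fin n → Carrier
    s a b = t a b + 1#

    adjProd : ∀ {N m} → Vec (Fin n) m → Vec (Fin N) m → Carrier
    adjProd [] [] = 1#
    adjProd (_ ∷ []) (_ ∷ []) = 1#
    adjProd (w₁ ∷ w₂ ∷ ws) (i₁ ∷ i₂ ∷ is) =
      (if ⌊ i₁ F.≟ i₂ ⌋ then s w₁ w₂ else 1#) * adjProd (w₂ ∷ ws) (i₂ ∷ is)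

    -- Ũ_t with variables x_{N+1}, x_{N+2}, … set to 0
    Ũ : (N : ℕ) → Poly N
    Ũ N = sumP (L.concatMap
            (λ w → L.map (λ i → adjProd w i • mono (expo i))
                         (L.filterᵇ weakInc (allVecs (L.allFin N) n)))
            (listings n))

    cycFactor : List (Fin n) → Carrier
    cycFactor γ = prodR (L.map (λ { (a , b) → s a b }) (CArcs γ))
                - prodR (L.map (λ { (a , b) → t a b }) (CArcs γ))

    RHS : (N : ℕ) → Poly N
    RHS N = sumP (L.map (λ σ → prodR (L.map cycFactor (cycles σ)) • pλ N (type σ)) (perms n))

{-# OPTIONS --safe #-}
-- For functions on finite sets (lists without repetition) use the product
-- (F · G) A = ∑ F p G q over ordered splittings of A into p and q; it is commutative and
-- associative, and F ↦ F (v ∷ _) is a derivation.  Summing a function of words over all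
-- arrangements of A, f ↦ ⟪ f ⟫, turns the deconcatenation product of words into this product.
-- Grouping the letters of a listing by colour, Ũ is ⟪ h₁ ⟫ · … · ⟪ h_N ⟫, where h_j weights a word
-- by x_j per letter and by s per arc.  Expanding products of s = t + 1 up to the first 1 gives
--   ⟪ h_j ⟫ (v ∷ A) = (C_{j,v} · ⟪ h_j ⟫) A,
-- where C_{j,v} sums ∏ s − ∏ t over the cycles through v, with x_j per letter.  By the Leibniz
-- rule Ũ (v ∷ A) = (∑_j C_{j,v} · Ũ) A, and removing the cycle through the least element v shows
-- that the sum over permutations satisfies the same recursion.  Permutations are matched with
-- partitions into cycles by an injection, which is onto because the recursion, with all weights
-- equal to 1, also counts both sides.
module Submission where

open import Defs
open import Level using (Level)
open import Algebra.Bundles using (CommutativeSemiring; CommutativeRing)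
import Algebra.Construct.Pointwise as Pointwise
import Algebra.Properties.Ring as RingProperties
import Algebra.Properties.Semiring.Exp as Exp
open import Data.Bool using (Bool; true; false; T; T?; not; _∧_; if_then_else_)
open import Data.Bool.ListAction using (any; all)
open import Data.Empty using (⊥)
open import Data.Fin as F using (Fin)
import Data.Fin.Properties as FP
open import Data.List as L using (List; []; _∷_; _++_)
import Data.List.Properties as LP
open import Data.List.Membership.Propositional using (_∈_; find; lose)
open import Data.List.Membership.Propositional.Properties
  using (∈-∃++; ∈-++⁺ʳ; ∈-++⁻; ∈-map⁺; ∈-map⁻; ∈-concatMap⁺; ∈-concatMap⁻; ∈-allFin; ∈-filter⁺; ∈-filter⁻)
import Data.List.Relation.Binary.Permutation.Propositional as Perm
open Perm using (_↭_; ↭-sym; ↭-trans; ↭-refl; ↭-reflexive)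
import Data.List.Relation.Binary.Permutation.Propositional.Properties as Permₚ
import Data.List.Relation.Binary.Permutation.Setoid.Properties as PermSetoid
open import Data.List.Relation.Ternary.Interleaving.Propositional
  using (Interleaving; []; consˡ; consʳ; toPermutation)
open import Data.List.Relation.Unary.All as All using (All; []; _∷_)
import Data.List.Relation.Unary.All.Properties as AllP
open import Data.List.Relation.Unary.AllPairs using (AllPairs; []; _∷_)
import Data.List.Relation.Unary.AllPairs.Properties as AllPairsP
open import Data.List.Relation.Unary.Any using (here; there)
open import Data.List.Relation.Unary.Unique.Propositional using (Unique)
import Data.List.Relation.Unary.Unique.Propositional.Properties as Uniqueₚ
open import Data.Nat as ℕ using (ℕ; zero; suc)
import Data.Nat.Properties as ℕₚ
open import Data.Product using (_×_; _,_; proj₁; proj₂; ∃)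
open import Data.Sum using (inj₁; inj₂)
open import Data.Vec as V using (Vec; []; _∷_)
import Data.Vec.Membership.Propositional.Properties as V∈
import Data.Vec.Properties as VP
open import Function using (_∘_; id)
open import Relation.Binary.PropositionalEquality as ≡ using (_≡_; _≢_)
open import Relation.Nullary using (¬_; Dec; yes; no)
open import Relation.Nullary.Decidable using (⌊_⌋)
open import Relation.Nullary.Negation using (contradiction)

-- The difference ∏ s - ∏ t arises as follows. Expand s = t + 1 along a cycle, arc by arc from `v`,
-- up to the first 1; that 1 is where the cycle is cut open, and only the term made of `t` alone has
-- no cut. A path leaving `v` expands in the same way, but there a missing 1 is harmless, because
-- the end of the path serves as the cut. Moving the piece in front of `v` behind the cut therefore
-- turns a path through `v` into a cycle through `v` and a shorter path. The calculus of words and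
-- sets is developed over an arbitrary commutative semiring because it is used twice: over the
-- polynomials, where each variable x_j is an ordinary scalar, and over ℕ with weights 1, where it
-- counts. The matching is built in one direction only. `table` turns a partition into a permutation
-- and `cycles` undoes it, so the orbits of an arbitrary permutation are never analysed; the
-- equality of the two counts stands in for that analysis.

-- Arrangements, splittings and cycle partitions of a list.

insertAll : {A : Set} → A → List A → List (List A)
insertAll x []      = (x ∷ []) ∷ []
insertAll x (y ∷ w) = (x ∷ y ∷ w) ∷ L.map (y ∷_) (insertAll x w)

arrangements : {A : Set} → List A → List (List A)
arrangements []      = [] ∷ []
arrangements (x ∷ A) = L.concatMap (insertAll x) (arrangements A)

splits : {A : Set} → List A → List (List A × List A)
splits []      = ([] , []) ∷ []
splits (x ∷ A) = L.map (λ (p , q) → x ∷ p , q) (splits A) ++ L.map (λ (p , q) → p , x ∷ q) (splits A)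

-- Set partitions of a list into cycles, each cycle written starting from its
-- earliest element and the cycles ordered by these elements.  The first
-- argument is fuel: any number not below the length of the list will do.
cyclePartitions : {A : Set} → ℕ → List A → List (List (List A))
cyclePartitions _       []      = [] ∷ []
cyclePartitions zero    (_ ∷ _) = []
cyclePartitions (suc k) (v ∷ A) =
  L.concatMap (λ (p , q) → L.concatMap (λ b → L.map ((v ∷ b) ∷_) (cyclePartitions k q)) (arrangements p))
              (splits A)

-- Finite sums and products in a commutative semiring.

module Sums {c ℓ : Level} (S : CommutativeSemiring c ℓ) where
  open CommutativeSemiring S hiding (zero)
  open import Algebra.Solver.Ring.NaturalCoefficients.Default S using (solve; _:=_; _:+_)

  ∑ : {a : Level} {A : Set a} → List A → (A → Carrier) → Carrier
  ∑ xs f = L.foldr _+_ 0# (L.map f xs)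

  ∏ : {a : Level} {A : Set a} → List A → (A → Carrier) → Carrier
  ∏ xs f = L.foldr _*_ 1# (L.map f xs)

  module _ {a : Level} {A : Set a} where

    ∑-cong : ∀ xs {f g : A → Carrier} → (∀ x → f x ≈ g x) → ∑ xs f ≈ ∑ xs g
    ∑-cong []       p = refl
    ∑-cong (x ∷ xs) p = +-cong (p x) (∑-cong xs p)

    ∑-cong-∈ : ∀ xs {f g : A → Carrier} → (∀ {x} → x ∈ xs → f x ≈ g x) → ∑ xs f ≈ ∑ xs g
    ∑-cong-∈ []       p = refl
    ∑-cong-∈ (x ∷ xs) p = +-cong (p (here ≡.refl)) (∑-cong-∈ xs (p ∘ there))

    ∑-filterᵇ : ∀ Q xs (f : A → Carrier) → ∑ (L.filterᵇ Q xs) f ≈ ∑ xs (λ x → if Q x then f x else 0#)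
    ∑-filterᵇ Q []       f = refl
    ∑-filterᵇ Q (x ∷ xs) f with Q x
    ... | true  = +-congˡ (∑-filterᵇ Q xs f)
    ... | false = trans (∑-filterᵇ Q xs f) (sym (+-identityˡ _))

    ∑-++ : ∀ xs ys (f : A → Carrier) → ∑ (xs ++ ys) f ≈ ∑ xs f + ∑ ys f
    ∑-++ []       ys f = sym (+-identityˡ _)
    ∑-++ (x ∷ xs) ys f = trans (+-congˡ (∑-++ xs ys f)) (sym (+-assoc _ _ _))

    ∑-zero : ∀ xs {f : A → Carrier} → (∀ x → f x ≈ 0#) → ∑ xs f ≈ 0#
    ∑-zero []       p = refl
    ∑-zero (x ∷ xs) p = trans (+-cong (p x) (∑-zero xs p)) (+-identityˡ _)

    ∑-+ : ∀ xs (f g : A → Carrier) → ∑ xs (λ x → f x + g x) ≈ ∑ xs f + ∑ xs g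
    ∑-+ []       f g = sym (+-identityˡ _)
    ∑-+ (x ∷ xs) f g = trans (+-congˡ (∑-+ xs f g))
      (solve 4 (λ a b c d → (a :+ b) :+ (c :+ d) := (a :+ c) :+ (b :+ d)) refl _ _ _ _)

    ∑-*ˡ : ∀ c xs (f : A → Carrier) → ∑ xs (λ x → c * f x) ≈ c * ∑ xs f
    ∑-*ˡ c []       f = sym (zeroʳ c)
    ∑-*ˡ c (x ∷ xs) f = trans (+-congˡ (∑-*ˡ c xs f)) (sym (distribˡ _ _ _))

    ∑-*ʳ : ∀ c xs (f : A → Carrier) → ∑ xs (λ x → f x * c) ≈ ∑ xs f * c
    ∑-*ʳ c []       f = sym (zeroˡ c)
    ∑-*ʳ c (x ∷ xs) f = trans (+-congˡ (∑-*ʳ c xs f)) (sym (distribʳ _ _ _))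

    ∑-↭ : ∀ {xs ys} (f : A → Carrier) → xs ↭ ys → ∑ xs f ≈ ∑ ys f
    ∑-↭ f Perm.refl          = refl
    ∑-↭ f (Perm.prep x p)    = +-congˡ (∑-↭ f p)
    ∑-↭ f (Perm.swap x y p)  = trans (+-congˡ (+-congˡ (∑-↭ f p)))
      (solve 3 (λ a b c → a :+ (b :+ c) := b :+ (a :+ c)) refl _ _ _)
    ∑-↭ f (Perm.trans p q)   = trans (∑-↭ f p) (∑-↭ f q)

  module _ {a b : Level} {A : Set a} {B : Set b} where

    ∑-map : ∀ (h : A → B) xs (f : B → Carrier) → ∑ (L.map h xs) f ≈ ∑ xs (λ x → f (h x))
    ∑-map h []       f = refl
    ∑-map h (x ∷ xs) f = +-congˡ (∑-map h xs f)

    ∑-concatMap : ∀ (h : A → List B) xs (f : B → Carrier) →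
                  ∑ (L.concatMap h xs) f ≈ ∑ xs (λ x → ∑ (h x) f)
    ∑-concatMap h []       f = refl
    ∑-concatMap h (x ∷ xs) f = trans (∑-++ (h x) _ f) (+-congˡ (∑-concatMap h xs f))

  module _ {a b d : Level} {A : Set a} {B : Set b} {D : Set d} where

    ∑-concatMap-map : ∀ (h : A → D → B) (g : A → List D) xs (f : B → Carrier) →
                      ∑ (L.concatMap (λ x → L.map (h x) (g x)) xs) f ≈ ∑ xs (λ x → ∑ (g x) (λ y → f (h x y)))
    ∑-concatMap-map h g xs f = trans (∑-concatMap _ xs f) (∑-cong xs (λ x → ∑-map (h x) (g x) f))

-- Functions of words and of finite sets

module Species {c ℓ : Level} (S : CommutativeSemiring c ℓ) (V : Set) where
  open CommutativeSemiring S hiding (zero)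
  open Sums S
  open import Relation.Binary.Reasoning.Setoid setoid
  open import Algebra.Solver.Ring.NaturalCoefficients.Default S using (solve; _:=_; _:+_; _:*_)

  Fun : Set c
  Fun = List V → Carrier

  infix 4 _≐_
  _≐_ : Fun → Fun → Set ℓ
  f ≐ g = ∀ w → f w ≈ g w

  infixr 6 _⊞_
  _⊞_ : Fun → Fun → Fun
  (f ⊞ g) w = f w + g w

  infixr 7 _⊡_ _⋆_ _·_
  _⊡_ : Carrier → Fun → Fun
  (a ⊡ f) w = a * f w

  infixl 8 _∣_
  _∣_ : Fun → V → Fun
  (f ∣ x) w = f (x ∷ w)

  -- (f ⋆ g) w = ∑ f u * g v over the deconcatenations w = u v
  _⋆_ : Fun → Fun → Fun
  (f ⋆ g) []      = f [] * g []
  (f ⋆ g) (x ∷ w) = f [] * g (x ∷ w) + ((f ∣ x) ⋆ g) w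

  -- (F · G) A = ∑ F p * G q over the splittings of A into subsequences p, q
  _·_ : Fun → Fun → Fun
  (F · G) []      = F [] * G []
  (F · G) (x ∷ A) = ((F ∣ x) · G) A + (F · (G ∣ x)) A

  -- The transpose of `insertAll`. Letting insertion act on functions instead of words makes the
  -- recursion of `⟪_⟫` structural in the list.
  ins : V → Fun → Fun
  ins x f []      = f (x ∷ [])
  ins x f (y ∷ w) = f (x ∷ y ∷ w) + ins x (f ∣ y) w

  -- ⟪ f ⟫ A sums f over all arrangements of A
  ⟪_⟫ : Fun → Fun
  ⟪ f ⟫ []      = f []
  ⟪ f ⟫ (x ∷ A) = ⟪ ins x f ⟫ A

  ⋆-⊞ˡ : ∀ f f′ g → (f ⊞ f′) ⋆ g ≐ (f ⋆ g) ⊞ (f′ ⋆ g)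
  ⋆-⊞ˡ f f′ g []      = distribʳ _ _ _
  ⋆-⊞ˡ f f′ g (x ∷ w) = trans (+-congˡ (⋆-⊞ˡ (f ∣ x) (f′ ∣ x) g w))
    (solve 5 (λ a b c d e → (a :+ b) :* c :+ (d :+ e) := (a :* c :+ d) :+ (b :* c :+ e)) refl _ _ _ _ _)

  ⋆-⊡ˡ : ∀ a f g → (a ⊡ f) ⋆ g ≐ a ⊡ (f ⋆ g)
  ⋆-⊡ˡ a f g []      = *-assoc _ _ _
  ⋆-⊡ˡ a f g (x ∷ w) = trans (+-congˡ (⋆-⊡ˡ a (f ∣ x) g w))
    (solve 4 (λ a b c d → (a :* b) :* c :+ a :* d := a :* (b :* c :+ d)) refl _ _ _ _)

  ins-cong : ∀ x {f g} → f ≐ g → ins x f ≐ ins x g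
  ins-cong x p []      = p _
  ins-cong x p (y ∷ w) = +-cong (p _) (ins-cong x (λ u → p (y ∷ u)) w)

  ins-⊞ : ∀ x f g → ins x (f ⊞ g) ≐ ins x f ⊞ ins x g
  ins-⊞ x f g []      = refl
  ins-⊞ x f g (y ∷ w) = trans (+-congˡ (ins-⊞ x (f ∣ y) (g ∣ y) w))
    (solve 4 (λ a b c d → (a :+ b) :+ (c :+ d) := (a :+ c) :+ (b :+ d)) refl _ _ _ _)

  ins-⊡ : ∀ x a f → ins x (a ⊡ f) ≐ a ⊡ ins x f
  ins-⊡ x a f []      = refl
  ins-⊡ x a f (y ∷ w) = trans (+-congˡ (ins-⊡ x a (f ∣ y) w)) (sym (distribˡ _ _ _))

  -- Once a word containing the new letter `x` is cut in two, `x` lies in exactly one of the parts;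
  -- this is a Leibniz rule. It matches the defining recursion of `·`, which is why `⟪⟫-⋆` holds.
  ins-⋆ : ∀ x f g → ins x (f ⋆ g) ≐ (ins x f ⋆ g) ⊞ (f ⋆ ins x g)
  ins-⋆ x f g []      = +-comm _ _
  ins-⋆ x f g (y ∷ w) = begin
    (f [] * g (x ∷ y ∷ w) + (f (x ∷ []) * g (y ∷ w) + ((f ∣ x ∣ y) ⋆ g) w))
      + ins x (f [] ⊡ (g ∣ y) ⊞ (f ∣ y) ⋆ g) w
      ≈⟨ +-congˡ (trans (ins-⊞ x (f [] ⊡ (g ∣ y)) ((f ∣ y) ⋆ g) w)
           (+-cong (ins-⊡ x (f []) (g ∣ y) w) (ins-⋆ x (f ∣ y) g w))) ⟩
    (f [] * g (x ∷ y ∷ w) + (f (x ∷ []) * g (y ∷ w) + ((f ∣ x ∣ y) ⋆ g) w))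
      + (f [] * ins x (g ∣ y) w + ((ins x (f ∣ y) ⋆ g) w + ((f ∣ y) ⋆ ins x g) w))
      ≈⟨ solve 8 (λ a b c d e h i j →
           (a :* b :+ (c :* d :+ e)) :+ (a :* h :+ (i :+ j))
           := (c :* d :+ (e :+ i)) :+ (a :* (b :+ h) :+ j)) refl _ _ _ _ _ _ _ _ ⟩
    (f (x ∷ []) * g (y ∷ w) + (((f ∣ x ∣ y) ⋆ g) w + (ins x (f ∣ y) ⋆ g) w))
      + (f [] * (g (x ∷ y ∷ w) + ins x (g ∣ y) w) + ((f ∣ y) ⋆ ins x g) w)
      ≈⟨ +-congʳ (+-congˡ (⋆-⊞ˡ (f ∣ x ∣ y) (ins x (f ∣ y)) g w)) ⟨
    ((ins x f ⋆ g) ⊞ (f ⋆ ins x g)) (y ∷ w) ∎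

  ⟪⟫-cong : ∀ {f g} → f ≐ g → ⟪ f ⟫ ≐ ⟪ g ⟫
  ⟪⟫-cong p []      = p []
  ⟪⟫-cong p (x ∷ A) = ⟪⟫-cong (ins-cong x p) A

  ⟪⟫-⊞ : ∀ f g → ⟪ f ⊞ g ⟫ ≐ ⟪ f ⟫ ⊞ ⟪ g ⟫
  ⟪⟫-⊞ f g []      = refl
  ⟪⟫-⊞ f g (x ∷ A) = trans (⟪⟫-cong (ins-⊞ x f g) A) (⟪⟫-⊞ (ins x f) (ins x g) A)

  ⟪⟫-⊡ : ∀ a f → ⟪ a ⊡ f ⟫ ≐ a ⊡ ⟪ f ⟫
  ⟪⟫-⊡ a f []      = refl
  ⟪⟫-⊡ a f (x ∷ A) = trans (⟪⟫-cong (ins-⊡ x a f) A) (⟪⟫-⊡ a (ins x f) A)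

  ⟪⟫-⋆ : ∀ f g → ⟪ f ⋆ g ⟫ ≐ ⟪ f ⟫ · ⟪ g ⟫
  ⟪⟫-⋆ f g []      = refl
  ⟪⟫-⋆ f g (x ∷ A) = begin
    ⟪ ins x (f ⋆ g) ⟫ A                                   ≈⟨ ⟪⟫-cong (ins-⋆ x f g) A ⟩
    ⟪ (ins x f ⋆ g) ⊞ (f ⋆ ins x g) ⟫ A                   ≈⟨ ⟪⟫-⊞ (ins x f ⋆ g) (f ⋆ ins x g) A ⟩
    ⟪ ins x f ⋆ g ⟫ A + ⟪ f ⋆ ins x g ⟫ A                 ≈⟨ +-cong (⟪⟫-⋆ (ins x f) g A) (⟪⟫-⋆ f (ins x g) A) ⟩
    (⟪ ins x f ⟫ · ⟪ g ⟫) A + (⟪ f ⟫ · ⟪ ins x g ⟫) A     ∎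

  -- The second factor only ever sees sublists of `A`. The length bound lets an induction hypothesis
  -- on shorter lists be used under the product.
  ·-cong-≤ : ∀ {F F′ G G′} A → F ≐ F′ → (∀ q → L.length q ℕ.≤ L.length A → G q ≈ G′ q) →
             (F · G) A ≈ (F′ · G′) A
  ·-cong-≤ []      p r = *-cong (p []) (r [] ℕ.z≤n)
  ·-cong-≤ (x ∷ A) p r = +-cong (·-cong-≤ A (λ u → p (x ∷ u)) (λ q h → r q (ℕₚ.m≤n⇒m≤1+n h)))
                                (·-cong-≤ A p (λ q h → r (x ∷ q) (ℕ.s≤s h)))

  ·-cong : ∀ {F F′ G G′} → F ≐ F′ → G ≐ G′ → F · G ≐ F′ · G′
  ·-cong p r A = ·-cong-≤ A p (λ q _ → r q)

  ·-comm : ∀ F G → F · G ≐ G · F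
  ·-comm F G []      = *-comm _ _
  ·-comm F G (x ∷ A) = trans (+-cong (·-comm (F ∣ x) G A) (·-comm F (G ∣ x) A)) (+-comm _ _)

  ·-⊞ˡ : ∀ F F′ G → (F ⊞ F′) · G ≐ (F · G) ⊞ (F′ · G)
  ·-⊞ˡ F F′ G []      = distribʳ _ _ _
  ·-⊞ˡ F F′ G (x ∷ A) = trans (+-cong (·-⊞ˡ (F ∣ x) (F′ ∣ x) G A) (·-⊞ˡ F F′ (G ∣ x) A))
    (solve 4 (λ a b c d → (a :+ b) :+ (c :+ d) := (a :+ c) :+ (b :+ d)) refl _ _ _ _)

  ·-⊞ʳ : ∀ F G G′ → F · (G ⊞ G′) ≐ (F · G) ⊞ (F · G′)
  ·-⊞ʳ F G G′ A = trans (·-comm F (G ⊞ G′) A)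
    (trans (·-⊞ˡ G G′ F A) (+-cong (·-comm G F A) (·-comm G′ F A)))

  ·-⊡ˡ : ∀ a F G → (a ⊡ F) · G ≐ a ⊡ (F · G)
  ·-⊡ˡ a F G []      = *-assoc _ _ _
  ·-⊡ˡ a F G (x ∷ A) = trans (+-cong (·-⊡ˡ a (F ∣ x) G A) (·-⊡ˡ a F (G ∣ x) A)) (sym (distribˡ _ _ _))

  ·-zeroˡ : ∀ G → (λ _ → 0#) · G ≐ (λ _ → 0#)
  ·-zeroˡ G []      = zeroˡ _
  ·-zeroˡ G (x ∷ A) = trans (+-cong (·-zeroˡ G A) (·-zeroˡ (G ∣ x) A)) (+-identityˡ _)

  ·-assoc : ∀ F G H → (F · G) · H ≐ F · (G · H)
  ·-assoc F G H []      = *-assoc _ _ _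
  ·-assoc F G H (x ∷ A) = begin
    (((F ∣ x) · G ⊞ F · (G ∣ x)) · H) A + ((F · G) · (H ∣ x)) A
      ≈⟨ +-cong (·-⊞ˡ ((F ∣ x) · G) (F · (G ∣ x)) H A) (·-assoc F G (H ∣ x) A) ⟩
    ((((F ∣ x) · G) · H) A + ((F · (G ∣ x)) · H) A) + (F · (G · (H ∣ x))) A
      ≈⟨ +-congʳ (+-cong (·-assoc (F ∣ x) G H A) (·-assoc F (G ∣ x) H A)) ⟩
    (((F ∣ x) · (G · H)) A + (F · ((G ∣ x) · H)) A) + (F · (G · (H ∣ x))) A
      ≈⟨ +-assoc _ _ _ ⟩
    ((F ∣ x) · (G · H)) A + ((F · ((G ∣ x) · H)) A + (F · (G · (H ∣ x))) A)
      ≈⟨ +-congˡ (·-⊞ʳ F ((G ∣ x) · H) (G · (H ∣ x)) A) ⟨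
    (F · (G · H)) (x ∷ A) ∎

  ∑-insertAll : ∀ x f w → ∑ (insertAll x w) f ≈ ins x f w
  ∑-insertAll x f []      = +-identityʳ _
  ∑-insertAll x f (y ∷ w) = +-congˡ (trans (∑-map (y ∷_) (insertAll x w) f) (∑-insertAll x (f ∣ y) w))

  ∑-arrangements : ∀ f A → ∑ (arrangements A) f ≈ ⟪ f ⟫ A
  ∑-arrangements f []      = +-identityʳ _
  ∑-arrangements f (x ∷ A) = begin
    ∑ (L.concatMap (insertAll x) (arrangements A)) f      ≈⟨ ∑-concatMap (insertAll x) (arrangements A) f ⟩
    ∑ (arrangements A) (λ w → ∑ (insertAll x w) f)        ≈⟨ ∑-cong (arrangements A) (∑-insertAll x f) ⟩
    ∑ (arrangements A) (ins x f)                          ≈⟨ ∑-arrangements (ins x f) A ⟩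
    ⟪ ins x f ⟫ A                                         ∎

  ∑-splits : ∀ F G A → ∑ (splits A) (λ (p , q) → F p * G q) ≈ (F · G) A
  ∑-splits F G []      = +-identityʳ _
  ∑-splits F G (x ∷ A) = trans (∑-++ (L.map _ (splits A)) _ _)
    (+-cong (trans (∑-map _ (splits A) _) (∑-splits (F ∣ x) G A))
            (trans (∑-map _ (splits A) _) (∑-splits F (G ∣ x) A)))

  ∑-cyclePartitions : ∀ (G : Fun) k v A →
    ∑ (cyclePartitions (suc k) (v ∷ A)) (λ cs → ∏ cs G)
      ≈ (⟪ G ∣ v ⟫ · (λ q → ∑ (cyclePartitions k q) (λ cs → ∏ cs G))) A
  ∑-cyclePartitions G k v A = begin
    ∑ (cyclePartitions (suc k) (v ∷ A)) (λ cs → ∏ cs G)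
      ≈⟨ ∑-concatMap _ (splits A) _ ⟩
    ∑ (splits A) (λ (p , q) → ∑ (L.concatMap (λ b → L.map ((v ∷ b) ∷_) (cyclePartitions k q)) (arrangements p))
                                (λ cs → ∏ cs G))
      ≈⟨ ∑-cong (splits A) (λ (p , q) → begin
           _ ≈⟨ ∑-concatMap-map (λ b → (v ∷ b) ∷_) (λ _ → cyclePartitions k q) (arrangements p) _ ⟩
           ∑ (arrangements p) (λ b → ∑ (cyclePartitions k q) (λ cs → G (v ∷ b) * ∏ cs G))
             ≈⟨ ∑-cong (arrangements p) (λ b → ∑-*ˡ (G (v ∷ b)) (cyclePartitions k q) _) ⟩
           ∑ (arrangements p) (λ b → G (v ∷ b) * ∑ (cyclePartitions k q) (λ cs → ∏ cs G))
             ≈⟨ ∑-*ʳ _ (arrangements p) _ ⟩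
           ∑ (arrangements p) (G ∣ v) * ∑ (cyclePartitions k q) (λ cs → ∏ cs G)
             ≈⟨ *-congʳ (∑-arrangements (G ∣ v) p) ⟩
           ⟪ G ∣ v ⟫ p * ∑ (cyclePartitions k q) (λ cs → ∏ cs G) ∎) ⟩
    ∑ (splits A) (λ (p , q) → ⟪ G ∣ v ⟫ p * ∑ (cyclePartitions k q) (λ cs → ∏ cs G))
      ≈⟨ ∑-splits ⟪ G ∣ v ⟫ _ A ⟩
    _ ∎

  -- The recursion expresses `F (v ∷ A)` through values of `F` on sublists of `A`, all shorter than
  -- `v ∷ A`, so it has only one solution. It is applied with weights 1 to count and with
  -- `cycleTerms` for the identity itself.
  ∑-cyclePartitions-unique : ∀ (G F : Fun) → F [] ≈ 1# → (∀ v A → F (v ∷ A) ≈ (⟪ G ∣ v ⟫ · F) A) →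
    ∀ k A → L.length A ℕ.≤ k → ∑ (cyclePartitions k A) (λ cs → ∏ cs G) ≈ F A
  ∑-cyclePartitions-unique G F F[] F∷ k       []      _          = trans (+-identityʳ _) (sym F[])
  ∑-cyclePartitions-unique G F F[] F∷ (suc k) (v ∷ A) (ℕ.s≤s h) = begin
    _ ≈⟨ ∑-cyclePartitions G k v A ⟩
    (⟪ G ∣ v ⟫ · (λ q → ∑ (cyclePartitions k q) (λ cs → ∏ cs G))) A
      ≈⟨ ·-cong-≤ A (λ _ → refl)
           (λ q q≤ → ∑-cyclePartitions-unique G F F[] F∷ k q (ℕₚ.≤-trans q≤ h)) ⟩
    (⟪ G ∣ v ⟫ · F) A ≈⟨ F∷ v A ⟨
    F (v ∷ A) ∎

-- An arrangement of `v ∷ A` is cut at `v` into two words. Reading one as the rest of the cycle of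
-- `v` and the other as an arrangement of what remains gives the recursion of cycle partitions with
-- all weights 1.
length-cyclePartitions : {V : Set} (A : List V) →
  L.length (cyclePartitions (L.length A) A) ≡ L.length (arrangements A)
length-cyclePartitions {V} A = begin
  L.length (cyclePartitions (L.length A) A)                   ≡⟨ ∑-one (λ cs → ∏-one cs) (cyclePartitions (L.length A) A) ⟨
  ∑ (cyclePartitions (L.length A) A) (λ cs → ∏ cs one)        ≡⟨ ∑-cyclePartitions-unique one ⟪ one ⟫ ≡.refl
                                                                   one-step (L.length A) A ℕₚ.≤-refl ⟩
  ⟪ one ⟫ A                                                   ≡⟨ ∑-arrangements one A ⟨
  ∑ (arrangements A) one                                      ≡⟨ ∑-one (λ _ → ≡.refl) (arrangements A) ⟩
  L.length (arrangements A)                                   ∎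
  where
  open ≡.≡-Reasoning
  open Sums ℕₚ.+-*-commutativeSemiring
  open Species ℕₚ.+-*-commutativeSemiring V
  one : Fun
  one _ = 1
  ∑-one : {B : Set} {f : B → ℕ} → (∀ x → f x ≡ 1) → ∀ xs → ∑ xs f ≡ L.length xs
  ∑-one h []       = ≡.refl
  ∑-one h (x ∷ xs) = ≡.cong₂ ℕ._+_ (h x) (∑-one h xs)
  ∏-one : ∀ cs → ∏ cs one ≡ 1
  ∏-one []       = ≡.refl
  ∏-one (_ ∷ cs) = ≡.trans (ℕₚ.*-identityˡ _) (∏-one cs)
  -- A place at which `v` can be inserted into a word is a cut of that word.
  ins-one : ∀ v → ins v one ≐ one ⋆ one
  ins-one v []      = ≡.refl
  ins-one v (y ∷ w) = ≡.cong suc (ins-one v w)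
  one-step : ∀ v A → ⟪ one ⟫ (v ∷ A) ≡ (⟪ one ⟫ · ⟪ one ⟫) A
  one-step v A = ≡.trans (⟪⟫-cong (ins-one v) A) (⟪⟫-⋆ one one A)

-- Path and cycle weights

arcs : {V : Set} → V → List V → V → List (V × V)
arcs x []      z = (x , z) ∷ []
arcs x (y ∷ w) z = (x , y) ∷ arcs y w z

module PathCycle {c ℓ : Level} (S : CommutativeRing c ℓ) {V : Set}
                 (t : V → V → CommutativeRing.Carrier S) where
  open CommutativeRing S hiding (zero)
  open Sums commutativeSemiring
  open Species commutativeSemiring V
  open Exp semiring using (_^_)
  open RingProperties ring using (-‿distribˡ-*)
  open import Relation.Binary.Reasoning.Setoid setoid
  open import Algebra.Solver.Ring.NaturalCoefficients.Default commutativeSemiring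
    using (solve; _:=_; _:+_; _:*_; con)

  t⁺ : V → V → Carrier
  t⁺ x y = t x y + 1#

  -- The value at `[]` is chosen to agree with `cycFactor []`, a difference of two empty products.
  cycleWeight : Fun
  cycleWeight []      = 0#
  cycleWeight (v ∷ w) = ∏ (arcs v w v) (λ (x , y) → t⁺ x y) - ∏ (arcs v w v) (λ (x , y) → t x y)

  module Coloured (X : Carrier) where

    -- Here and in `through` and `to`, the named end letters carry no factor `X`, so that pieces can
    -- be glued at a letter without counting its variable twice.
    from : (V → V → Carrier) → V → Fun
    from a x []      = 1#
    from a x (y ∷ w) = a x y * (X * from a y w)

    through : (V → V → Carrier) → V → V → Fun
    through a z x []      = a x z
    through a z x (y ∷ w) = a x y * (X * through a z y w)

    path : Fun
    path []      = 1#
    path (x ∷ w) = X * from t⁺ x w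

    to : V → Fun
    to v []      = 1#
    to v (x ∷ w) = X * through t⁺ v x w

    -- The inserted `v` cuts the path: the letters before it lead from `x` into `v`, those after it
    -- leave `v`, and the extra `X` is the variable of `v`.
    ins-from : ∀ v x → ins v (from t⁺ x) ≐ X ⊡ (through t⁺ v x ⋆ from t⁺ v)
    ins-from v x []      = solve 2 (λ a b → a :* (b :* con 1) := b :* (a :* con 1)) refl _ _
    ins-from v x (y ∷ w) = begin
      t⁺ x v * (X * from t⁺ v (y ∷ w)) + ins v (t⁺ x y ⊡ X ⊡ from t⁺ y) w
        ≈⟨ +-congˡ (trans (ins-⊡ v (t⁺ x y) (X ⊡ from t⁺ y) w)
             (*-congˡ (trans (ins-⊡ v X (from t⁺ y) w) (*-congˡ (ins-from v y w))))) ⟩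
      t⁺ x v * (X * from t⁺ v (y ∷ w)) + t⁺ x y * (X * (X * (through t⁺ v y ⋆ from t⁺ v) w))
        ≈⟨ solve 5 (λ a b c d e → a :* (b :* c) :+ d :* (b :* (b :* e)) := b :* (a :* c :+ d :* (b :* e)))
             refl _ _ _ _ _ ⟩
      X * (t⁺ x v * from t⁺ v (y ∷ w) + t⁺ x y * (X * (through t⁺ v y ⋆ from t⁺ v) w))
        ≈⟨ *-congˡ (+-congˡ (trans (⋆-⊡ˡ (t⁺ x y) (X ⊡ through t⁺ v y) (from t⁺ v) w)
             (*-congˡ (⋆-⊡ˡ X (through t⁺ v y) (from t⁺ v) w)))) ⟨
      (X ⊡ (through t⁺ v x ⋆ from t⁺ v)) (y ∷ w) ∎

    ins-path : ∀ v → ins v path ≐ X ⊡ (to v ⋆ from t⁺ v)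
    ins-path v []      = solve 1 (λ a → a :* con 1 := a :* (con 1 :* con 1)) refl _
    ins-path v (y ∷ w) = begin
      X * from t⁺ v (y ∷ w) + ins v (X ⊡ from t⁺ y) w
        ≈⟨ +-congˡ (trans (ins-⊡ v X (from t⁺ y) w) (*-congˡ (ins-from v y w))) ⟩
      X * from t⁺ v (y ∷ w) + X * (X * (through t⁺ v y ⋆ from t⁺ v) w)
        ≈⟨ solve 3 (λ a b c → a :* b :+ a :* (a :* c) := a :* (con 1 :* b :+ a :* c)) refl _ _ _ ⟩
      X * (1# * from t⁺ v (y ∷ w) + X * (through t⁺ v y ⋆ from t⁺ v) w)
        ≈⟨ *-congˡ (+-congˡ (⋆-⊡ˡ X (through t⁺ v y) (from t⁺ v) w)) ⟨
      (X ⊡ (to v ⋆ from t⁺ v)) (y ∷ w) ∎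

    -- Expand the factors t⁺ = t + 1 from the left, up to the first 1 chosen.
    from-split : ∀ v → from t⁺ v ≐ from t v ⋆ path
    from-split v []      = sym (*-identityˡ _)
    from-split v (y ∷ w) = begin
      (t v y + 1#) * (X * from t⁺ y w)
        ≈⟨ solve 3 (λ a b c → (a :+ con 1) :* (b :* c) := con 1 :* (b :* c) :+ a :* (b :* c)) refl _ _ _ ⟩
      1# * (X * from t⁺ y w) + t v y * (X * from t⁺ y w)
        ≈⟨ +-congˡ (*-congˡ (*-congˡ (from-split y w))) ⟩
      1# * (X * from t⁺ y w) + t v y * (X * (from t y ⋆ path) w)
        ≈⟨ +-congˡ (trans (⋆-⊡ˡ (t v y) (X ⊡ from t y) path w) (*-congˡ (⋆-⊡ˡ X (from t y) path w))) ⟨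
      (from t v ⋆ path) (y ∷ w) ∎

    -- The expansion is that of `from-split`, but the term in which no 1 is chosen has to stand
    -- apart: an empty second word in the `⋆` product already means that the 1 was chosen on the
    -- last arc, the one into `v`.
    through-split : ∀ v x → through t⁺ v x ≐ (from t x ⋆ to v) ⊞ through t v x
    through-split v x []      = trans (+-comm _ _) (+-congʳ (sym (*-identityˡ _)))
    through-split v x (y ∷ w) = begin
      (t x y + 1#) * (X * through t⁺ v y w)
        ≈⟨ solve 3 (λ a b c → (a :+ con 1) :* (b :* c) := con 1 :* (b :* c) :+ a :* (b :* c)) refl _ _ _ ⟩
      1# * (X * through t⁺ v y w) + t x y * (X * through t⁺ v y w)
        ≈⟨ +-congˡ (*-congˡ (*-congˡ (through-split v y w))) ⟩
      1# * (X * through t⁺ v y w) + t x y * (X * ((from t y ⋆ to v) w + through t v y w))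
        ≈⟨ solve 5 (λ a b c d e → a :+ b :* (c :* (d :+ e)) := (a :+ b :* (c :* d)) :+ b :* (c :* e))
             refl _ _ _ _ _ ⟩
      (1# * (X * through t⁺ v y w) + t x y * (X * (from t y ⋆ to v) w)) + t x y * (X * through t v y w)
        ≈⟨ +-congʳ (+-congˡ (trans (⋆-⊡ˡ (t x y) (X ⊡ from t y) (to v) w)
             (*-congˡ (⋆-⊡ˡ X (from t y) (to v) w)))) ⟨
      ((from t x ⋆ to v) ⊞ through t v x) (y ∷ w) ∎

    through-∏ : ∀ a v x w → through a v x w ≈ ∏ (arcs x w v) (λ (y , z) → a y z) * X ^ L.length w
    through-∏ a v x []      = solve 1 (λ b → b := (b :* con 1) :* con 1) refl _
    through-∏ a v x (y ∷ w) = trans (*-congˡ (*-congˡ (through-∏ a v y w)))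
      (solve 4 (λ a b c d → a :* (b :* (c :* d)) := (a :* c) :* (b :* d)) refl _ _ _ _)

    -- Subtracting ∏ t removes precisely the exceptional term of `through-split`. What is left is a
    -- genuine product of words, so `⟪⟫-⋆` applies to it.
    cycle-split : ∀ v → (λ w → cycleWeight (v ∷ w) * X ^ L.length w) ≐ from t v ⋆ to v
    cycle-split v w = begin
      (σ - τ) * X ^ L.length w                             ≈⟨ distribʳ _ _ _ ⟩
      σ * X ^ L.length w + (- τ) * X ^ L.length w          ≈⟨ +-congˡ (-‿distribˡ-* _ _) ⟨
      σ * X ^ L.length w - τ * X ^ L.length w              ≈⟨ +-cong (through-∏ t⁺ v v w) (-‿cong (through-∏ t v v w)) ⟨
      through t⁺ v v w - through t v v w                    ≈⟨ +-congʳ (through-split v v w) ⟩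
      ((from t v ⋆ to v) w + through t v v w) - through t v v w ≈⟨ +-assoc _ _ _ ⟩
      (from t v ⋆ to v) w + (through t v v w - through t v v w) ≈⟨ +-congˡ (-‿inverseʳ _) ⟩
      (from t v ⋆ to v) w + 0#                             ≈⟨ +-identityʳ _ ⟩
      (from t v ⋆ to v) w                                  ∎
      where
      σ τ : Carrier
      σ = ∏ (arcs v w v) (λ (x , y) → t⁺ x y)
      τ = ∏ (arcs v w v) (λ (x , y) → t x y)

    cycleThrough : V → Fun
    cycleThrough v w = cycleWeight (v ∷ w) * X ^ suc (L.length w)

    -- Both sides sum over all words c, b₁, b₂ the weight s(c v) t(v b₁) s(b₂).  On the left it
    -- comes from the path c v b₁ b₂, on the right from the cycle v b₁ c and the path b₂.
    ⟪path⟫-∷ : ∀ v A → ⟪ path ⟫ (v ∷ A) ≈ (⟪ cycleThrough v ⟫ · ⟪ path ⟫) A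
    ⟪path⟫-∷ v A = begin
      ⟪ ins v path ⟫ A
        ≈⟨ trans (⟪⟫-cong (ins-path v) A) (⟪⟫-⊡ X (to v ⋆ from t⁺ v) A) ⟩
      X * ⟪ to v ⋆ from t⁺ v ⟫ A
        ≈⟨ *-congˡ (⟪⟫-⋆ (to v) (from t⁺ v) A) ⟩
      X * (⟪ to v ⟫ · ⟪ from t⁺ v ⟫) A
        ≈⟨ *-congˡ (·-cong (λ _ → refl) (λ B → trans (⟪⟫-cong (from-split v) B) (⟪⟫-⋆ (from t v) path B)) A) ⟩
      X * (⟪ to v ⟫ · (⟪ from t v ⟫ · ⟪ path ⟫)) A
        ≈⟨ *-congˡ (·-assoc ⟪ to v ⟫ ⟪ from t v ⟫ ⟪ path ⟫ A) ⟨
      X * ((⟪ to v ⟫ · ⟪ from t v ⟫) · ⟪ path ⟫) A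
        ≈⟨ *-congˡ (·-cong (·-comm ⟪ to v ⟫ ⟪ from t v ⟫) (λ _ → refl) A) ⟩
      X * ((⟪ from t v ⟫ · ⟪ to v ⟫) · ⟪ path ⟫) A
        ≈⟨ *-congˡ (·-cong (⟪⟫-⋆ (from t v) (to v)) (λ _ → refl) A) ⟨
      X * (⟪ from t v ⋆ to v ⟫ · ⟪ path ⟫) A
        ≈⟨ ·-⊡ˡ X ⟪ from t v ⋆ to v ⟫ ⟪ path ⟫ A ⟨
      ((X ⊡ ⟪ from t v ⋆ to v ⟫) · ⟪ path ⟫) A
        ≈⟨ ·-cong (⟪⟫-⊡ X (from t v ⋆ to v)) (λ _ → refl) A ⟨
      (⟪ X ⊡ (from t v ⋆ to v) ⟫ · ⟪ path ⟫) A
        ≈⟨ ·-cong (⟪⟫-cong (λ w → trans (*-congˡ (sym (cycle-split v w)))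
             (solve 3 (λ a b c → a :* (b :* c) := b :* (a :* c)) refl _ _ _))) (λ _ → refl) A ⟩
      (⟪ cycleThrough v ⟫ · ⟪ path ⟫) A ∎

  open Coloured public using (from; path)
  open Coloured using (cycleThrough; ⟪path⟫-∷)

  module Palette {J : Set} (X : J → Carrier) where

    -- Weakly increasing colours cut a word into consecutive blocks, one per colour and possibly
    -- empty, with weight 1 on the arcs between blocks. The base case is the unit of `⋆`.
    paths : List J → Fun
    paths []       []      = 1#
    paths []       (_ ∷ _) = 0#
    paths (j ∷ js) = path (X j) ⋆ paths js

    powerSum : List J → ℕ → Carrier
    powerSum js m = ∑ js (λ j → X j ^ m)

    cycleTerms : List J → Fun
    cycleTerms js w = cycleWeight w * powerSum js (L.length w)

    paths-[] : ∀ js → paths js [] ≈ 1#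
    paths-[] []       = refl
    paths-[] (j ∷ js) = trans (*-identityˡ _) (paths-[] js)

    -- The letter `v` lies in the block of a single colour, and the recursion for that block brings
    -- out a cycle through `v`. Commutativity carries the cycle factor to the front, where the
    -- contributions of the colours add up to a power sum.
    ⟪paths⟫-∷ : ∀ js v A → ⟪ paths js ⟫ (v ∷ A) ≈ (⟪ cycleTerms js ∣ v ⟫ · ⟪ paths js ⟫) A
    -- Without colours both sides vanish: no nonempty word can be coloured, and the power sums are
    -- empty.
    ⟪paths⟫-∷ [] v A = begin
      ⟪ ins v (paths []) ⟫ A                       ≈⟨ ⟪⟫-cong ins-ε A ⟩
      ⟪ (λ _ → 0#) ⟫ A                             ≈⟨ ⟪0⟫ A ⟩
      0#                                           ≈⟨ ·-zeroˡ ⟪ paths [] ⟫ A ⟨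
      ((λ _ → 0#) · ⟪ paths [] ⟫) A                ≈⟨ ·-cong ⟪0⟫ (λ _ → refl) A ⟨
      (⟪ (λ _ → 0#) ⟫ · ⟪ paths [] ⟫) A            ≈⟨ ·-cong (⟪⟫-cong (λ w → zeroʳ _)) (λ _ → refl) A ⟨
      (⟪ cycleTerms [] ∣ v ⟫ · ⟪ paths [] ⟫) A         ∎
      where
      ins-0 : ∀ v → ins v (λ _ → 0#) ≐ (λ _ → 0#)
      ins-0 v []      = refl
      ins-0 v (y ∷ w) = trans (+-identityˡ _) (ins-0 v w)
      ins-ε : ins v (paths []) ≐ (λ _ → 0#)
      ins-ε []      = refl
      ins-ε (y ∷ w) = trans (+-identityˡ _) (ins-0 v w)
      ⟪0⟫ : ⟪ (λ _ → 0#) ⟫ ≐ (λ _ → 0#)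
      ⟪0⟫ []      = refl
      ⟪0⟫ (x ∷ B) = trans (⟪⟫-cong (ins-0 x) B) (⟪0⟫ B)
    ⟪paths⟫-∷ (j ∷ js) v A = begin
      ⟪ p ⋆ q ⟫ (v ∷ A)
        ≈⟨ ⟪⟫-⋆ p q (v ∷ A) ⟩
      ((⟪ p ⟫ ∣ v) · Q) A + (P · (Q ∣ v)) A
        ≈⟨ +-cong (·-cong (⟪path⟫-∷ (X j) v) (λ _ → refl) A) (·-cong (λ _ → refl) (⟪paths⟫-∷ js v) A) ⟩
      ((C · P) · Q) A + (P · (D · Q)) A
        ≈⟨ +-cong (·-assoc C P Q A) (sym (·-assoc P D Q A)) ⟩
      (C · (P · Q)) A + ((P · D) · Q) A
        ≈⟨ +-congˡ (trans (·-cong (·-comm P D) (λ _ → refl) A) (·-assoc D P Q A)) ⟩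
      (C · (P · Q)) A + (D · (P · Q)) A
        ≈⟨ ·-⊞ˡ C D (P · Q) A ⟨
      ((C ⊞ D) · (P · Q)) A
        ≈⟨ ·-cong (λ B → trans (sym (⟪⟫-⊞ (cycleThrough (X j) v) (cycleTerms js ∣ v) B))
                                (⟪⟫-cong (λ w → sym (distribˡ _ _ _)) B))
                  (λ B → sym (⟪⟫-⋆ p q B)) A ⟩
      (⟪ cycleTerms (j ∷ js) ∣ v ⟫ · ⟪ p ⋆ q ⟫) A ∎
      where
      p q P Q C D : Fun
      p = path (X j)
      q = paths js
      P = ⟪ p ⟫
      Q = ⟪ q ⟫
      C = ⟪ cycleThrough (X j) v ⟫
      D = ⟪ cycleTerms js ∣ v ⟫

    ∑-paths≈∑-cycles : ∀ js A → ∑ (arrangements A) (paths js)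
                              ≈ ∑ (cyclePartitions (L.length A) A) (λ cs → ∏ cs (cycleTerms js))
    ∑-paths≈∑-cycles js A = trans (∑-arrangements (paths js) A)
      (sym (∑-cyclePartitions-unique (cycleTerms js) ⟪ paths js ⟫ (paths-[] js) (⟪paths⟫-∷ js) (L.length A) A ≤-refl))
      where open import Data.Nat.Properties using (≤-refl)

-- The ring of polynomials

module Polynomials {c ℓ : Level} (R : CommutativeRing c ℓ) where
  open CommutativeRing R hiding (zero)
  open Sums commutativeSemiring
  open import Relation.Binary.Reasoning.Setoid setoid

  infixl 7 _⊛_
  _⊛_ : ∀ {N} → Poly R N → Poly R N → Poly R N
  _⊛_ = _⊗_ R

  infixl 6 _⊞_
  _⊞_ : ∀ {N} → Poly R N → Poly R N → Poly R N
  _⊞_ = _⊕_ R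

  infixr 8 _⊡_
  _⊡_ : ∀ {N} → Carrier → Poly R N → Poly R N
  _⊡_ = _•_ R

  infix 4 _≐_
  _≐_ : ∀ {N} → Poly R N → Poly R N → Set ℓ
  _≐_ = _≈ₚ_ R

  𝟘 𝟙 : ∀ {N} → Poly R N
  𝟘 _ = 0#
  𝟙 {N} = mono R (V.replicate N 0)

  -- Poly (suc N) is treated as power series in the first variable over Poly N:
  -- slice f a is the coefficient of its a-th power, and shift drops the constant term.
  slice : ∀ {N} → Poly R (suc N) → ℕ → Poly R N
  slice f a α = f (a ∷ α)

  shift : ∀ {N} → Poly R (suc N) → Poly R (suc N)
  shift f (a ∷ α) = f (suc a ∷ α)

  ⊛-cong : ∀ {N} {f f′ g g′ : Poly R N} → f ≐ f′ → g ≐ g′ → f ⊛ g ≐ f′ ⊛ g′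
  ⊛-cong p q α = ∑-cong (below R α) (λ β → *-cong (p β) (q _))

  ⊛-congʳ : ∀ {N} (g : Poly R N) {f f′ : Poly R N} → f ≐ f′ → f ⊛ g ≐ f′ ⊛ g
  ⊛-congʳ g p = ⊛-cong {g = g} p (λ _ → refl)

  ⊛-congˡ : ∀ {N} (f : Poly R N) {g g′ : Poly R N} → g ≐ g′ → f ⊛ g ≐ f ⊛ g′
  ⊛-congˡ f p = ⊛-cong {f = f} (λ _ → refl) p

  ⊛-distribʳ : ∀ {N} (g f f′ : Poly R N) → (f ⊞ f′) ⊛ g ≐ f ⊛ g ⊞ f′ ⊛ g
  ⊛-distribʳ g f f′ α = trans (∑-cong (below R α) (λ β → distribʳ _ _ _)) (∑-+ (below R α) _ _)

  ⊛-⊡ : ∀ {N} a (f g : Poly R N) → (a ⊡ f) ⊛ g ≐ a ⊡ (f ⊛ g)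
  ⊛-⊡ a f g α = trans (∑-cong (below R α) (λ β → *-assoc _ _ _)) (∑-*ˡ a (below R α) _)

  ⊛-zeroˡ : ∀ {N} (g : Poly R N) → 𝟘 ⊛ g ≐ 𝟘
  ⊛-zeroˡ g α = ∑-zero (below R α) (λ β → zeroˡ _)

  ⊛-∷ : ∀ {N} (f g : Poly R (suc N)) a α →
        (f ⊛ g) (a ∷ α) ≈ ∑ (L.upTo (suc a)) (λ b → (slice f b ⊛ slice g (a ℕ.∸ b)) α)
  ⊛-∷ f g a α = ∑-concatMap-map _∷_ (λ _ → below R α) (L.upTo (suc a)) _

  ⊛-[] : (f g : Poly R 0) → (f ⊛ g) [] ≈ f [] * g []
  ⊛-[] f g = +-identityʳ _

  ⊛-0∷ : ∀ {N} (f g : Poly R (suc N)) α → (f ⊛ g) (0 ∷ α) ≈ (slice f 0 ⊛ slice g 0) α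
  ⊛-0∷ f g α = trans (⊛-∷ f g 0 α) (+-identityʳ _)

  ⊛-suc∷ : ∀ {N} (f g : Poly R (suc N)) a α →
           (f ⊛ g) (suc a ∷ α) ≈ (slice f 0 ⊛ slice g (suc a)) α + (shift f ⊛ g) (a ∷ α)
  ⊛-suc∷ f g a α = trans (⊛-∷ f g (suc a) α) (+-congˡ (begin
    ∑ (L.applyUpTo suc (suc a)) (λ b → (slice f b ⊛ slice g (suc a ℕ.∸ b)) α)
      ≡⟨ ≡.cong (λ xs → ∑ xs (λ b → (slice f b ⊛ slice g (suc a ℕ.∸ b)) α)) (LP.map-upTo suc (suc a)) ⟨
    ∑ (L.map suc (L.upTo (suc a))) (λ b → (slice f b ⊛ slice g (suc a ℕ.∸ b)) α)
      ≈⟨ ∑-map suc (L.upTo (suc a)) _ ⟩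
    ∑ (L.upTo (suc a)) (λ b → (slice (shift f) b ⊛ slice g (a ℕ.∸ b)) α)
      ≈⟨ ⊛-∷ (shift f) g a α ⟨
    (shift f ⊛ g) (a ∷ α) ∎))

  -- `⊛-suc∷` splits off the first term of the convolution, this one the last. Exchanging the
  -- factors turns one rule into the other, which is the inductive step of `⊛-comm`.
  ⊛-suc∷ʳ : ∀ {N} (f g : Poly R (suc N)) a α →
            (f ⊛ g) (suc a ∷ α) ≈ (f ⊛ shift g) (a ∷ α) + (slice f (suc a) ⊛ slice g 0) α
  ⊛-suc∷ʳ f g zero    α = trans (⊛-suc∷ f g 0 α)
    (+-cong (sym (⊛-0∷ f (shift g) α)) (⊛-0∷ (shift f) g α))
  ⊛-suc∷ʳ f g (suc a) α = begin
    (f ⊛ g) (suc (suc a) ∷ α)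
      ≈⟨ ⊛-suc∷ f g (suc a) α ⟩
    (slice f 0 ⊛ slice g (suc (suc a))) α + (shift f ⊛ g) (suc a ∷ α)
      ≈⟨ +-congˡ (⊛-suc∷ʳ (shift f) g a α) ⟩
    (slice f 0 ⊛ slice g (suc (suc a))) α
      + ((shift f ⊛ shift g) (a ∷ α) + (slice f (suc (suc a)) ⊛ slice g 0) α)
      ≈⟨ +-assoc _ _ _ ⟨
    ((slice f 0 ⊛ slice g (suc (suc a))) α + (shift f ⊛ shift g) (a ∷ α))
      + (slice f (suc (suc a)) ⊛ slice g 0) α
      ≈⟨ +-congʳ (⊛-suc∷ f (shift g) a α) ⟨
    (f ⊛ shift g) (suc a ∷ α) + (slice f (suc (suc a)) ⊛ slice g 0) α ∎

  ⊛-comm : ∀ {N} (f g : Poly R N) → f ⊛ g ≐ g ⊛ f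
  ⊛-comm f g []          = trans (⊛-[] f g) (trans (*-comm _ _) (sym (⊛-[] g f)))
  ⊛-comm f g (zero ∷ α)  = trans (⊛-0∷ f g α) (trans (⊛-comm (slice f 0) (slice g 0) α) (sym (⊛-0∷ g f α)))
  ⊛-comm f g (suc a ∷ α) = begin
    (f ⊛ g) (suc a ∷ α)                                          ≈⟨ ⊛-suc∷ f g a α ⟩
    (slice f 0 ⊛ slice g (suc a)) α + (shift f ⊛ g) (a ∷ α)      ≈⟨ +-cong (⊛-comm (slice f 0) (slice g (suc a)) α)
                                                                          (⊛-comm (shift f) g (a ∷ α)) ⟩
    (slice g (suc a) ⊛ slice f 0) α + (g ⊛ shift f) (a ∷ α)      ≈⟨ +-comm _ _ ⟩
    (g ⊛ shift f) (a ∷ α) + (slice g (suc a) ⊛ slice f 0) α      ≈⟨ ⊛-suc∷ʳ g f a α ⟨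
    (g ⊛ f) (suc a ∷ α)                                          ∎

  ⊛-distribˡ : ∀ {N} (f g g′ : Poly R N) → f ⊛ (g ⊞ g′) ≐ f ⊛ g ⊞ f ⊛ g′
  ⊛-distribˡ f g g′ α = trans (⊛-comm f (g ⊞ g′) α)
    (trans (⊛-distribʳ f g g′ α) (+-cong (⊛-comm g f α) (⊛-comm g′ f α)))

  -- Multiplication by a polynomial free of the first variable. It appears when `shift` is applied
  -- to a product.
  scale : ∀ {N} → Poly R N → Poly R (suc N) → Poly R (suc N)
  scale e g (b ∷ β) = (e ⊛ slice g b) β

  -- Associativity is assumed at the exponent `α` alone, so that `⊛-assoc` can supply a recursive
  -- call on the smaller exponent vector.
  scale-⊛ : ∀ {N} (e : Poly R N) α → (∀ g h → ((e ⊛ g) ⊛ h) α ≈ (e ⊛ (g ⊛ h)) α) →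
            ∀ g h b → (scale e g ⊛ h) (b ∷ α) ≈ (e ⊛ slice (g ⊛ h) b) α
  scale-⊛ e α assoc g h zero    = begin
    (scale e g ⊛ h) (0 ∷ α)               ≈⟨ ⊛-0∷ (scale e g) h α ⟩
    ((e ⊛ slice g 0) ⊛ slice h 0) α       ≈⟨ assoc (slice g 0) (slice h 0) ⟩
    (e ⊛ (slice g 0 ⊛ slice h 0)) α       ≈⟨ ⊛-congˡ e (⊛-0∷ g h) α ⟨
    (e ⊛ slice (g ⊛ h) 0) α               ∎
  scale-⊛ e α assoc g h (suc b) = begin
    (scale e g ⊛ h) (suc b ∷ α)
      ≈⟨ ⊛-suc∷ (scale e g) h b α ⟩
    ((e ⊛ slice g 0) ⊛ slice h (suc b)) α + (shift (scale e g) ⊛ h) (b ∷ α)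
      ≈⟨ +-cong (assoc (slice g 0) (slice h (suc b)))
           (trans (⊛-congʳ h (λ { (_ ∷ _) → refl }) (b ∷ α)) (scale-⊛ e α assoc (shift g) h b)) ⟩
    (e ⊛ (slice g 0 ⊛ slice h (suc b))) α + (e ⊛ slice (shift g ⊛ h) b) α
      ≈⟨ ⊛-distribˡ e (slice g 0 ⊛ slice h (suc b)) (slice (shift g ⊛ h) b) α ⟨
    (e ⊛ (slice g 0 ⊛ slice h (suc b) ⊞ slice (shift g ⊛ h) b)) α
      ≈⟨ ⊛-congˡ e (⊛-suc∷ g h b) α ⟨
    (e ⊛ slice (g ⊛ h) (suc b)) α ∎

  ⊛-assoc : ∀ {N} (f g h : Poly R N) → (f ⊛ g) ⊛ h ≐ f ⊛ (g ⊛ h)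
  ⊛-assoc f g h []          = begin
    ((f ⊛ g) ⊛ h) []           ≈⟨ trans (⊛-[] (f ⊛ g) h) (*-congʳ (⊛-[] f g)) ⟩
    (f [] * g []) * h []       ≈⟨ *-assoc _ _ _ ⟩
    f [] * (g [] * h [])       ≈⟨ trans (⊛-[] f (g ⊛ h)) (*-congˡ (⊛-[] g h)) ⟨
    (f ⊛ (g ⊛ h)) []           ∎
  ⊛-assoc f g h (zero ∷ α)  = begin
    ((f ⊛ g) ⊛ h) (0 ∷ α)                          ≈⟨ ⊛-0∷ (f ⊛ g) h α ⟩
    (slice (f ⊛ g) 0 ⊛ slice h 0) α                ≈⟨ ⊛-congʳ (slice h 0) (⊛-0∷ f g) α ⟩
    ((slice f 0 ⊛ slice g 0) ⊛ slice h 0) α        ≈⟨ ⊛-assoc (slice f 0) (slice g 0) (slice h 0) α ⟩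
    (slice f 0 ⊛ (slice g 0 ⊛ slice h 0)) α        ≈⟨ ⊛-congˡ (slice f 0) (⊛-0∷ g h) α ⟨
    (slice f 0 ⊛ slice (g ⊛ h) 0) α                ≈⟨ ⊛-0∷ f (g ⊛ h) α ⟨
    (f ⊛ (g ⊛ h)) (0 ∷ α)                          ∎
  ⊛-assoc {suc N} f g h (suc a ∷ α) = begin
    ((f ⊛ g) ⊛ h) (suc a ∷ α)
      ≈⟨ ⊛-suc∷ (f ⊛ g) h a α ⟩
    (slice (f ⊛ g) 0 ⊛ h₊) α + (shift (f ⊛ g) ⊛ h) (a ∷ α)
      -- `shift` obeys a twisted Leibniz rule: the shift of f g is f₀ times the shift of g, plus the
      -- shift of f times g.
      ≈⟨ +-cong (⊛-congʳ h₊ (⊛-0∷ f g) α)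
                (⊛-congʳ h (λ { (b ∷ β) → ⊛-suc∷ f g b β }) (a ∷ α)) ⟩
    ((f₀ ⊛ slice g 0) ⊛ h₊) α + ((scale f₀ (shift g) ⊞ shift f ⊛ g) ⊛ h) (a ∷ α)
      ≈⟨ +-cong (⊛-assoc f₀ (slice g 0) h₊ α) (⊛-distribʳ h (scale f₀ (shift g)) (shift f ⊛ g) (a ∷ α)) ⟩
    (f₀ ⊛ (slice g 0 ⊛ h₊)) α + ((scale f₀ (shift g) ⊛ h) (a ∷ α) + ((shift f ⊛ g) ⊛ h) (a ∷ α))
      ≈⟨ +-congˡ (+-cong (scale-⊛ f₀ α (λ p q → ⊛-assoc f₀ p q α) (shift g) h a)
                         (⊛-assoc (shift f) g h (a ∷ α))) ⟩
    (f₀ ⊛ (slice g 0 ⊛ h₊)) α + ((f₀ ⊛ slice (shift g ⊛ h) a) α + (shift f ⊛ (g ⊛ h)) (a ∷ α))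
      ≈⟨ +-assoc _ _ _ ⟨
    ((f₀ ⊛ (slice g 0 ⊛ h₊)) α + (f₀ ⊛ slice (shift g ⊛ h) a) α) + (shift f ⊛ (g ⊛ h)) (a ∷ α)
      ≈⟨ +-congʳ (⊛-distribˡ f₀ (slice g 0 ⊛ h₊) (slice (shift g ⊛ h) a) α) ⟨
    (f₀ ⊛ (slice g 0 ⊛ h₊ ⊞ slice (shift g ⊛ h) a)) α + (shift f ⊛ (g ⊛ h)) (a ∷ α)
      ≈⟨ +-congʳ (⊛-congˡ f₀ (⊛-suc∷ g h a) α) ⟨
    (f₀ ⊛ slice (g ⊛ h) (suc a)) α + (shift f ⊛ (g ⊛ h)) (a ∷ α)
      ≈⟨ ⊛-suc∷ f (g ⊛ h) a α ⟨
    (f ⊛ (g ⊛ h)) (suc a ∷ α) ∎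
    where
    f₀ h₊ : Poly R N
    f₀ = slice f 0
    h₊ = slice h (suc a)

  -- Monomials and the ring structure.

  mono-≡ : ∀ {N} (α β : Vec ℕ N) → α ≡ β → mono R α β ≈ 1#
  mono-≡ α β p with VP.≡-dec ℕ._≟_ α β
  ... | yes _ = refl
  ... | no ¬p = contradiction p ¬p

  mono-≢ : ∀ {N} (α β : Vec ℕ N) → (α ≡ β → ⊥) → mono R α β ≈ 0#
  mono-≢ α β ¬p with VP.≡-dec ℕ._≟_ α β
  ... | yes p = contradiction p ¬p
  ... | no _  = refl

  mono-resp : ∀ {N M} (α β : Vec ℕ N) (α′ β′ : Vec ℕ M) →
              (α ≡ β → α′ ≡ β′) → (α′ ≡ β′ → α ≡ β) → mono R α β ≈ mono R α′ β′
  mono-resp α β α′ β′ to from with VP.≡-dec ℕ._≟_ α β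
  ... | yes p = sym (mono-≡ α′ β′ (to p))
  ... | no ¬p = sym (mono-≢ α′ β′ (¬p ∘ from))

  mono-suc∷ : ∀ {N} a b (α β : Vec ℕ N) → mono R (suc a ∷ α) (suc b ∷ β) ≈ mono R (a ∷ α) (b ∷ β)
  mono-suc∷ a b α β = mono-resp (suc a ∷ α) (suc b ∷ β) (a ∷ α) (b ∷ β)
    (λ { ≡.refl → ≡.refl }) (λ { ≡.refl → ≡.refl })

  -- The left factor has only its slice of degree 0, so a single term of the convolution survives.
  mono-0∷-⊛ : ∀ {N} (α : Vec ℕ N) (g : Poly R (suc N)) b β →
              (mono R (0 ∷ α) ⊛ g) (b ∷ β) ≈ (mono R α ⊛ slice g b) β
  mono-0∷-⊛ α g b β = trans (head b) (⊛-congʳ (slice g b)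
    {slice (mono R (0 ∷ α)) 0} {mono R α} (λ γ → mono-resp (0 ∷ α) (0 ∷ γ) α γ VP.∷-injectiveʳ (≡.cong (0 ∷_))) β)
    where
    head : ∀ b → (mono R (0 ∷ α) ⊛ g) (b ∷ β) ≈ (slice (mono R (0 ∷ α)) 0 ⊛ slice g b) β
    head zero    = ⊛-0∷ (mono R (0 ∷ α)) g β
    head (suc b) = trans (⊛-suc∷ (mono R (0 ∷ α)) g b β) (trans (+-congˡ (trans
      (⊛-congʳ g {f′ = 𝟘} (λ { (_ ∷ _) → refl }) (b ∷ β)) (⊛-zeroˡ g (b ∷ β)))) (+-identityʳ _))

  mono-suc∷-⊛-0∷ : ∀ {N} a (α : Vec ℕ N) (g : Poly R (suc N)) β → (mono R (suc a ∷ α) ⊛ g) (0 ∷ β) ≈ 0#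
  mono-suc∷-⊛-0∷ a α g β = trans (⊛-0∷ (mono R (suc a ∷ α)) g β)
    (trans (⊛-congʳ (slice g 0) {f′ = 𝟘} (λ γ → refl) β) (⊛-zeroˡ (slice g 0) β))

  mono-suc∷-⊛-suc∷ : ∀ {N} a (α : Vec ℕ N) (g : Poly R (suc N)) b β →
                     (mono R (suc a ∷ α) ⊛ g) (suc b ∷ β) ≈ (mono R (a ∷ α) ⊛ g) (b ∷ β)
  mono-suc∷-⊛-suc∷ a α g b β = trans (⊛-suc∷ (mono R (suc a ∷ α)) g b β) (trans (+-cong
    (trans (⊛-congʳ (slice g (suc b)) {f′ = 𝟘} (λ γ → refl) β) (⊛-zeroˡ (slice g (suc b)) β))
    (⊛-congʳ g (λ { (c ∷ γ) → mono-suc∷ a c α γ }) (b ∷ β))) (+-identityˡ _))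

  mono-⊛-mono : ∀ {N} (α β : Vec ℕ N) → mono R α ⊛ mono R β ≐ mono R (V.zipWith ℕ._+_ α β)
  mono-⊛-mono []          []      []          = trans (⊛-[] (mono R []) (mono R []))
    (trans (*-cong refl refl) (trans (*-identityˡ _) (sym refl)))
  mono-⊛-mono (zero ∷ α)  (b ∷ β) (c ∷ γ)     = trans (mono-0∷-⊛ α (mono R (b ∷ β)) c γ) (cases (b ℕ.≟ c))
    where
    cases : Dec (b ≡ c) → (mono R α ⊛ slice (mono R (b ∷ β)) c) γ ≈ mono R (b ∷ V.zipWith ℕ._+_ α β) (c ∷ γ)
    cases (yes ≡.refl) = trans (⊛-congˡ (mono R α) (λ δ → mono-resp (b ∷ β) (b ∷ δ) β δ VP.∷-injectiveʳ (≡.cong (b ∷_))) γ)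
      (trans (mono-⊛-mono α β γ) (mono-resp (V.zipWith ℕ._+_ α β) γ (b ∷ V.zipWith ℕ._+_ α β) (b ∷ γ) (≡.cong (b ∷_)) VP.∷-injectiveʳ))
    cases (no b≢c) = trans (⊛-congˡ (mono R α) {g′ = 𝟘} (λ δ → mono-≢ (b ∷ β) (c ∷ δ) (b≢c ∘ VP.∷-injectiveˡ)) γ)
      (trans (⊛-comm (mono R α) 𝟘 γ) (trans (⊛-zeroˡ (mono R α) γ) (sym (mono-≢ (b ∷ V.zipWith ℕ._+_ α β) (c ∷ γ) (b≢c ∘ VP.∷-injectiveˡ)))))
  mono-⊛-mono (suc a ∷ α) (b ∷ β) (zero ∷ γ)  = trans (mono-suc∷-⊛-0∷ a α (mono R (b ∷ β)) γ) (sym (refl))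
  mono-⊛-mono (suc a ∷ α) (b ∷ β) (suc c ∷ γ) = trans (mono-suc∷-⊛-suc∷ a α (mono R (b ∷ β)) c γ)
    (trans (mono-⊛-mono (a ∷ α) (b ∷ β) (c ∷ γ))
      (sym (mono-suc∷ (a ℕ.+ b) c (V.zipWith ℕ._+_ α β) γ)))

  ⊛-identityˡ : ∀ {N} (g : Poly R N) → 𝟙 ⊛ g ≐ g
  ⊛-identityˡ g []      = trans (⊛-[] 𝟙 g) (trans (*-congʳ refl) (*-identityˡ _))
  ⊛-identityˡ g (b ∷ β) = trans (mono-0∷-⊛ (V.replicate _ 0) g b β) (⊛-identityˡ (slice g b) β)

  polyRing : ℕ → CommutativeRing c ℓ
  polyRing N = record
    { Carrier = Poly R N
    ; _≈_ = _≐_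
    ; _+_ = _⊞_
    ; _*_ = _⊛_
    ; -_ = λ f α → - f α
    ; 0# = 𝟘
    ; 1# = 𝟙
    ; isCommutativeRing = record
      { isRing = record
        { +-isAbelianGroup = Pointwise.isAbelianGroup (Vec ℕ N) +-isAbelianGroup
        ; *-cong = ⊛-cong
        ; *-assoc = ⊛-assoc
        ; *-identity = ⊛-identityˡ , λ g α → trans (⊛-comm g 𝟙 α) (⊛-identityˡ g α)
        ; distrib = ⊛-distribˡ , ⊛-distribʳ
        }
      ; *-comm = ⊛-comm
      }
    }

-- Listings as arrangements

module _ {A : Set} where

  Unique-resp-↭ : {xs ys : List A} → xs ↭ ys → Unique xs → Unique ys
  Unique-resp-↭ p = PermSetoid.Unique-resp-↭ (≡.setoid A) (Perm.↭⇒↭ₛ p)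

  unique-⊆-complement : {xs ys : List A} → Unique xs → (∀ {x} → x ∈ xs → x ∈ ys) → ∃ λ zs → ys ↭ xs ++ zs
  unique-⊆-complement {ys = ys} [] _ = ys , ↭-refl
  unique-⊆-complement {x ∷ xs} (x∉xs ∷ u) sub with ∈-∃++ (sub (here ≡.refl))
  ... | as , bs , ≡.refl with unique-⊆-complement {ys = as ++ bs} u sub′
    where
    sub′ : ∀ {y} → y ∈ xs → y ∈ as ++ bs
    sub′ y∈ with Permₚ.∈-resp-↭ (Permₚ.shift x as bs) (sub (there y∈))
    ... | here ≡.refl = contradiction ≡.refl (All.lookup x∉xs y∈)
    ... | there y∈′   = y∈′
  ... | zs , p = zs , ↭-trans (Permₚ.shift x as bs) (Perm.prep x p)

  unique-⊆-length : {xs ys : List A} → Unique xs → (∀ {x} → x ∈ xs → x ∈ ys) → L.length xs ℕ.≤ L.length ys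
  unique-⊆-length {xs} u sub with unique-⊆-complement u sub
  ... | zs , p = ≡.subst (L.length xs ℕ.≤_)
    (≡.sym (≡.trans (Permₚ.↭-length p) (LP.length-++ xs))) (ℕₚ.m≤m+n _ _)

  -- The pigeonhole principle: a nonempty complement would make `ys` longer than `xs`. It turns an
  -- injection between lists of equal length into a bijection.
  unique-⊆-↭ : {xs ys : List A} → Unique xs → (∀ {x} → x ∈ xs → x ∈ ys) →
               L.length ys ℕ.≤ L.length xs → xs ↭ ys
  unique-⊆-↭ {xs} {ys} u sub le with unique-⊆-complement u sub
  ... | []     , p = ↭-sym (↭-trans p (↭-reflexive (LP.++-identityʳ xs)))
  ... | z ∷ zs , p = contradiction le (ℕₚ.<⇒≱
    (≡.subst (L.length xs ℕ.<_) (≡.sym (≡.trans (Permₚ.↭-length p) (LP.length-++ xs)))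
      (ℕₚ.m<m+n (L.length xs) ℕ.z<s)))

  unique-sameElements-↭ : {xs ys : List A} → Unique xs → Unique ys → (∀ {x} → x ∈ xs → x ∈ ys) →
                          (∀ {x} → x ∈ ys → x ∈ xs) → xs ↭ ys
  unique-sameElements-↭ u v sub sup = unique-⊆-↭ u sub (unique-⊆-length v sup)

module _ {A B : Set} where

  concatMap-unique : (f : A → List B) {xs : List A} → Unique xs → (∀ {x} → x ∈ xs → Unique (f x)) →
                     (∀ {x y z} → x ∈ xs → y ∈ xs → z ∈ f x → z ∈ f y → x ≡ y) →
                     Unique (L.concatMap f xs)
  concatMap-unique f []              _ _ = []
  concatMap-unique f {x ∷ xs} (x∉ ∷ u) fu inj =
    Uniqueₚ.++⁺ (fu (here ≡.refl)) (concatMap-unique f u (fu ∘ there) (λ p q → inj (there p) (there q)))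
      λ (z∈x , z∈xs) → let y∈ = ∈-concatMap⁻ f {xs = xs} z∈xs
                           y , y∈xs , z∈y = find y∈ in
        All.lookup x∉ y∈xs (inj (here ≡.refl) (there y∈xs) z∈x z∈y)

module _ {A : Set} where

  insertAll-sound : ∀ (x : A) w {u} → u ∈ insertAll x w → u ↭ x ∷ w
  insertAll-sound x []      (here ≡.refl) = ↭-refl
  insertAll-sound x (y ∷ w) (here ≡.refl) = ↭-refl
  insertAll-sound x (y ∷ w) (there u∈) with ∈-map⁻ (y ∷_) u∈
  ... | u , u∈′ , ≡.refl = ↭-trans (Perm.prep y (insertAll-sound x w u∈′)) (Perm.swap y x ↭-refl)

  insertAll-complete : ∀ (x : A) as bs → as ++ x ∷ bs ∈ insertAll x (as ++ bs)
  insertAll-complete x []       []       = here ≡.refl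
  insertAll-complete x []       (b ∷ bs) = here ≡.refl
  insertAll-complete x (a ∷ as) bs       = there (∈-map⁺ (a ∷_) (insertAll-complete x as bs))

  arrangements-sound : ∀ (A : List A) {w} → w ∈ arrangements A → w ↭ A
  arrangements-sound []      (here ≡.refl) = ↭-refl
  arrangements-sound (x ∷ A) w∈ with find (∈-concatMap⁻ (insertAll x) {xs = arrangements A} w∈)
  ... | u , u∈ , w∈u = ↭-trans (insertAll-sound x u w∈u) (Perm.prep x (arrangements-sound A u∈))

  arrangements-complete : ∀ (A : List A) {w} → w ↭ A → w ∈ arrangements A
  arrangements-complete []      p with ≡.refl ← Permₚ.↭-empty-inv p = here ≡.refl
  arrangements-complete (x ∷ A) {w} p with ∈-∃++ (Permₚ.∈-resp-↭ (↭-sym p) (here ≡.refl))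
  ... | as , bs , ≡.refl = ∈-concatMap⁺ (insertAll x)
    (lose (arrangements-complete A (Permₚ.drop-mid as [] p)) (insertAll-complete x as bs))

  insertAll-unique : ∀ {x : A} {w} → All (x ≢_) w → Unique (insertAll x w)
  insertAll-unique []         = [] ∷ []
  insertAll-unique {x} {y ∷ w} (x≢y ∷ x∉w) =
    All.tabulate (λ u∈ eq → x≢y (LP.∷-injectiveˡ (≡.trans eq (proj₂ (proj₂ (∈-map⁻ (y ∷_) u∈))))))
    ∷ Uniqueₚ.map⁺ LP.∷-injectiveʳ (insertAll-unique x∉w)

  -- Since `x` occurs in neither `u` nor `v`, deleting it from `w` recovers both.
  insertAll-injective : ∀ {x : A} {u v w} → All (x ≢_) u → All (x ≢_) v →
                        w ∈ insertAll x u → w ∈ insertAll x v → u ≡ v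
  insertAll-injective {u = []}    {[]}    _ _ _ _ = ≡.refl
  insertAll-injective {u = []}    {z ∷ v} _ (x≢z ∷ _) (here ≡.refl) (there q) with ∈-map⁻ (z ∷_) q
  ... | _ , _ , ≡.refl = contradiction ≡.refl x≢z
  insertAll-injective {u = y ∷ u} {[]}    (x≢y ∷ _) _ (there p) (here ≡.refl) with ∈-map⁻ (y ∷_) p
  ... | _ , _ , ≡.refl = contradiction ≡.refl x≢y
  insertAll-injective {u = y ∷ u} {z ∷ v} _ _ (here ≡.refl) (here ≡.refl) = ≡.refl
  insertAll-injective {u = y ∷ u} {z ∷ v} _ (x≢z ∷ _) (here ≡.refl) (there q) with ∈-map⁻ (z ∷_) q
  ... | _ , _ , ≡.refl = contradiction ≡.refl x≢z
  insertAll-injective {u = y ∷ u} {z ∷ v} (x≢y ∷ _) _ (there p) (here ≡.refl) with ∈-map⁻ (y ∷_) p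
  ... | _ , _ , ≡.refl = contradiction ≡.refl x≢y
  insertAll-injective {u = y ∷ u} {z ∷ v} (_ ∷ x∉u) (_ ∷ x∉v) (there p) (there q)
    with ∈-map⁻ (y ∷_) p | ∈-map⁻ (z ∷_) q
  ... | w , p′ , ≡.refl | _ , q′ , ≡.refl = ≡.cong (y ∷_) (insertAll-injective x∉u x∉v p′ q′)

  arrangements-unique : {A : List A} → Unique A → Unique (arrangements A)
  arrangements-unique []         = [] ∷ []
  arrangements-unique {x ∷ A} (x∉A ∷ u) = concatMap-unique (insertAll x) (arrangements-unique u)
    (insertAll-unique ∘ avoid) (λ p q → insertAll-injective (avoid p) (avoid q))
    where
    avoid : ∀ {w} → w ∈ arrangements A → All (x ≢_) w
    avoid w∈ = Permₚ.All-resp-↭ (↭-sym (arrangements-sound A w∈)) x∉A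

allVecs-complete : {A : Set} {xs : List A} → (∀ x → x ∈ xs) → ∀ {m} (w : Vec A m) → w ∈ allVecs xs m
allVecs-complete h []      = here ≡.refl
allVecs-complete {xs = xs} h (x ∷ w) = ∈-concatMap⁺ (λ y → L.map (y ∷_) (allVecs xs _))
  (lose (h x) (∈-map⁺ (x ∷_) (allVecs-complete h w)))

allVecs-unique : {A : Set} {xs : List A} → Unique xs → ∀ m → Unique (allVecs xs m)
allVecs-unique u zero    = [] ∷ []
allVecs-unique {xs = xs} u (suc m) = concatMap-unique (λ x → L.map (x ∷_) (allVecs xs m)) u
  (λ _ → Uniqueₚ.map⁺ VP.∷-injectiveʳ (allVecs-unique u m))
  λ {x} {y} _ _ p q → VP.∷-injectiveˡ (≡.trans (≡.sym (proj₂ (proj₂ (∈-map⁻ (x ∷_) p)))) (proj₂ (proj₂ (∈-map⁻ (y ∷_) q))))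

module _ {n : ℕ} where

  private
    occurs : Fin n → List (Fin n) → Bool
    occurs x = any (λ y → ⌊ x F.≟ y ⌋)

  occurs-sound : ∀ x ys → T (not (occurs x ys)) → All (x ≢_) ys
  occurs-sound x []       _ = []
  occurs-sound x (y ∷ ys) h with x F.≟ y
  ... | no x≢y = x≢y ∷ occurs-sound x ys h

  occurs-complete : ∀ x {ys} → All (x ≢_) ys → T (not (occurs x ys))
  occurs-complete x []         = _
  occurs-complete x {y ∷ _} (x≢y ∷ h) with x F.≟ y
  ... | yes x≡y = x≢y x≡y
  ... | no _    = occurs-complete x h

  distinct-sound : ∀ {m} (w : Vec (Fin n) m) → T (distinct w) → Unique (V.toList w)
  distinct-sound []      _ = []
  distinct-sound (x ∷ w) h with occurs x (V.toList w) in eq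
  ... | false = occurs-sound x (V.toList w) (≡.subst (T ∘ not) (≡.sym eq) _) ∷ distinct-sound w h

  distinct-complete : ∀ {m} (w : Vec (Fin n) m) → Unique (V.toList w) → T (distinct w)
  distinct-complete []      _ = _
  distinct-complete (x ∷ w) (h ∷ u) with occurs x (V.toList w) | occurs-complete x h
  ... | false | _ = distinct-complete w u

  unique-full : {xs : List (Fin n)} → Unique xs → L.length xs ≡ n → xs ↭ L.allFin n
  unique-full u len = unique-⊆-↭ u (λ _ → ∈-allFin _)
    (ℕₚ.≤-reflexive (≡.trans (LP.length-tabulate id) (≡.sym len)))

listings-unique : ∀ n → Unique (listings n)
listings-unique n = Uniqueₚ.filter⁺ (T? ∘ distinct) (allVecs-unique (Uniqueₚ.allFin⁺ n) n)

∈-listings⁺ : ∀ {n} (w : Vec (Fin n) n) → Unique (V.toList w) → w ∈ listings n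
∈-listings⁺ w u = ∈-filter⁺ (T? ∘ distinct) (allVecs-complete ∈-allFin w) (distinct-complete w u)

∈-listings⁻ : ∀ {n} {w : Vec (Fin n) n} → w ∈ listings n → Unique (V.toList w)
∈-listings⁻ {n} {w} w∈ = distinct-sound w (proj₂ (∈-filter⁻ (T? ∘ distinct) {xs = allVecs (L.allFin n) n} w∈))

listings-↭-arrangements : ∀ n → L.map V.toList (listings n) ↭ arrangements (L.allFin n)
listings-↭-arrangements n = unique-sameElements-↭
  (Uniqueₚ.map⁺ toList-inj (listings-unique n))
  (arrangements-unique (Uniqueₚ.allFin⁺ n)) to from
  where
  toList-inj : ∀ {v w : Vec (Fin n) n} → V.toList v ≡ V.toList w → v ≡ w
  toList-inj {v} {w} eq = ≡.trans (≡.sym (VP.cast-is-id ≡.refl v)) (VP.toList-injective ≡.refl v w eq)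
  to : ∀ {u} → u ∈ L.map V.toList (listings n) → u ∈ arrangements (L.allFin n)
  to u∈ with ∈-map⁻ V.toList u∈
  ... | w , w∈ , ≡.refl = arrangements-complete (L.allFin n)
    (unique-full (∈-listings⁻ w∈) (VP.length-toList w))
  from : ∀ {u} → u ∈ arrangements (L.allFin n) → u ∈ L.map V.toList (listings n)
  from {u} u∈ with arrangements-sound (L.allFin n) u∈
  ... | p with ≡.trans (Permₚ.↭-length p) (LP.length-tabulate id)
  ... | len = ≡.subst (_∈ L.map V.toList (listings n)) eq
    (∈-map⁺ V.toList (∈-listings⁺ w (≡.subst Unique (≡.sym eq) (Unique-resp-↭ (↭-sym p) (Uniqueₚ.allFin⁺ n)))))
    where
    w : Vec (Fin n) n
    w = V.cast len (V.fromList u)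
    eq : V.toList w ≡ u
    eq = ≡.trans (VP.toList-cast len (V.fromList u)) (VP.toList∘fromList u)

-- Partitions into cycles

module _ {V : Set} where

  ∈-splits⁻ : ∀ (A : List V) {p q} → (p , q) ∈ splits A → Interleaving p q A
  ∈-splits⁻ []      (here ≡.refl) = []
  ∈-splits⁻ (x ∷ A) pq∈ with ∈-++⁻ (L.map _ (splits A)) pq∈
  ... | inj₁ l with ∈-map⁻ _ l
  ...   | _ , l′ , ≡.refl = consˡ (∈-splits⁻ A l′)
  ∈-splits⁻ (x ∷ A) pq∈ | inj₂ r with ∈-map⁻ _ r
  ...   | _ , r′ , ≡.refl = consʳ (∈-splits⁻ A r′)

  module _ {ℓ : Level} {P : V → Set ℓ} where

    interleaving-All : ∀ {p q A} → Interleaving p q A → All P A → All P p × All P q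
    interleaving-All i h = AllP.++⁻ _ (Permₚ.All-resp-↭ (toPermutation i) h)

  interleaving-AllPairs : {ℓ : Level} {_∼_ : V → V → Set ℓ} → ∀ {p q A} → Interleaving p q A →
                          AllPairs _∼_ A → AllPairs _∼_ p × AllPairs _∼_ q
  interleaving-AllPairs []        []       = [] , []
  interleaving-AllPairs (consˡ i) (h ∷ hs) =
    let hp , hq = interleaving-AllPairs i hs in proj₁ (interleaving-All i h) ∷ hp , hq
  interleaving-AllPairs (consʳ i) (h ∷ hs) =
    let hp , hq = interleaving-AllPairs i hs in hp , proj₂ (interleaving-All i h) ∷ hq

  -- When the letters are distinct, the set of letters of `p` decides where each letter goes. The
  -- hypothesis is only `↭` because a cycle reveals `p` only up to order.
  interleaving-injective : ∀ {p q p′ q′ A} → Unique A → Interleaving p q A → Interleaving p′ q′ A →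
                           p ↭ p′ → (p , q) ≡ (p′ , q′)
  interleaving-injective []      []        []        _ = ≡.refl
  interleaving-injective (h ∷ u) (consˡ i) (consˡ j) r
    with ≡.refl ← interleaving-injective u i j (Permₚ.drop-∷ r) = ≡.refl
  interleaving-injective (h ∷ u) (consʳ i) (consʳ j) r
    with ≡.refl ← interleaving-injective u i j r = ≡.refl
  interleaving-injective (h ∷ u) (consˡ i) (consʳ j) r =
    contradiction ≡.refl (All.lookup (proj₁ (interleaving-All j h)) (Permₚ.∈-resp-↭ r (here ≡.refl)))
  interleaving-injective (h ∷ u) (consʳ i) (consˡ j) r =
    contradiction ≡.refl (All.lookup (proj₁ (interleaving-All i h)) (Permₚ.∈-resp-↭ (↭-sym r) (here ≡.refl)))

  splits-unique : {A : List V} → Unique A → Unique (splits A)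
  splits-unique []      = [] ∷ []
  splits-unique {x ∷ A} (h ∷ u) = Uniqueₚ.++⁺
    (Uniqueₚ.map⁺ (λ { ≡.refl → ≡.refl }) (splits-unique u))
    (Uniqueₚ.map⁺ (λ { ≡.refl → ≡.refl }) (splits-unique u))
    λ (l , r) → disjoint (∈-map⁻ _ l) (∈-map⁻ _ r)
    where
    disjoint : ∀ {z} → (∃ λ (pq : List V × List V) → pq ∈ splits A × z ≡ (x ∷ proj₁ pq , proj₂ pq)) →
               (∃ λ (pq : List V × List V) → pq ∈ splits A × z ≡ (proj₁ pq , x ∷ proj₂ pq)) → ⊥
    disjoint (_ , _ , ≡.refl) (_ , r , ≡.refl) =
      All.lookup (proj₁ (interleaving-All (∈-splits⁻ A r) h)) (here ≡.refl) ≡.refl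

  -- The shape of the members of `cyclePartitions`, freed from the fuel, for induction on the
  -- partition.
  data Canonical : List V → List (List V) → Set where
    []  : Canonical [] []
    add : ∀ {v A p q b cs} → Interleaving p q A → b ↭ p → Canonical q cs → Canonical (v ∷ A) ((v ∷ b) ∷ cs)

  ∈-cyclePartitions⁻-∷ : ∀ k (v : V) A {cs} → cs ∈ cyclePartitions (suc k) (v ∷ A) →
    ∃ λ pq → pq ∈ splits A × ∃ λ b → b ∈ arrangements (proj₁ pq) × ∃ λ ds →
      ds ∈ cyclePartitions k (proj₂ pq) × cs ≡ (v ∷ b) ∷ ds
  ∈-cyclePartitions⁻-∷ k v A cs∈ with find (∈-concatMap⁻ _ {xs = splits A} cs∈)
  ... | (p , q) , pq∈ , cs∈′ with find (∈-concatMap⁻ _ {xs = arrangements p} cs∈′)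
  ... | b , b∈ , cs∈″ = (p , q) , pq∈ , b , b∈ , ∈-map⁻ _ cs∈″

  ∈-cyclePartitions⁻ : ∀ k (A : List V) {cs} → cs ∈ cyclePartitions k A → Canonical A cs
  ∈-cyclePartitions⁻ k       []      (here ≡.refl) = []
  ∈-cyclePartitions⁻ (suc k) (v ∷ A) cs∈ with ∈-cyclePartitions⁻-∷ k v A cs∈
  ... | (p , q) , pq∈ , b , b∈ , ds , ds∈ , ≡.refl =
    add (∈-splits⁻ A pq∈) (arrangements-sound p b∈) (∈-cyclePartitions⁻ k q ds∈)

  -- A partition displays its first cycle, hence `b`, hence the letters of `p`, and these determine
  -- the splitting.
  cyclePartitions-unique : ∀ k {A : List V} → Unique A → Unique (cyclePartitions k A)
  cyclePartitions-unique k       {[]}    _ = [] ∷ []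
  cyclePartitions-unique zero    {_ ∷ _} _ = []
  cyclePartitions-unique (suc k) {v ∷ A} (_ ∷ u) = concatMap-unique _ (splits-unique u)
    (λ {(p , q)} pq∈ → let up , uq = interleaving-AllPairs (∈-splits⁻ A pq∈) u in
      concatMap-unique _ (arrangements-unique up)
        (λ _ → Uniqueₚ.map⁺ LP.∷-injectiveʳ (cyclePartitions-unique k uq))
        (λ {b} {b′} _ _ l r → same-head (∈-map⁻ ((v ∷ b) ∷_) l) (∈-map⁻ ((v ∷ b′) ∷_) r)))
    (λ {(p , q)} {(p′ , q′)} pq∈ pq∈′ l r → same-split pq∈ pq∈′
      (find (∈-concatMap⁻ (λ b → L.map ((v ∷ b) ∷_) (cyclePartitions k q)) {xs = arrangements p} l))
      (find (∈-concatMap⁻ (λ b → L.map ((v ∷ b) ∷_) (cyclePartitions k q′)) {xs = arrangements p′} r)))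
    where
    same-head : ∀ {b b′ z} {B B′ : List (List (List V))} → (∃ λ ds → ds ∈ B × z ≡ (v ∷ b) ∷ ds) →
                (∃ λ ds → ds ∈ B′ × z ≡ (v ∷ b′) ∷ ds) → b ≡ b′
    same-head (_ , _ , ≡.refl) (_ , _ , ≡.refl) = ≡.refl
    same-split : ∀ {p q p′ q′ z} {B B′ : List (List (List V))} → (p , q) ∈ splits A → (p′ , q′) ∈ splits A →
                 (∃ λ b → b ∈ arrangements p × z ∈ L.map ((v ∷ b) ∷_) B) →
                 (∃ λ b → b ∈ arrangements p′ × z ∈ L.map ((v ∷ b) ∷_) B′) → (p , q) ≡ (p′ , q′)
    same-split {p} {p′ = p′} pq∈ pq∈′ (b , b∈ , l) (b′ , b∈′ , r)
      with ≡.refl ← same-head (∈-map⁻ ((v ∷ b) ∷_) l) (∈-map⁻ ((v ∷ b′) ∷_) r) =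
      interleaving-injective u (∈-splits⁻ A pq∈) (∈-splits⁻ A pq∈′)
        (↭-trans (↭-sym (arrangements-sound p b∈)) (arrangements-sound p′ b∈′))

  canonical-concat : ∀ {A cs} → Canonical A cs → L.concat cs ↭ A
  canonical-concat []                    = ↭-refl
  canonical-concat (add {v = v} i b↭p c) =
    Perm.prep v (↭-trans (Permₚ.++⁺ b↭p (canonical-concat c)) (↭-sym (toPermutation i)))

  HeadLeast : (V → V → Set) → List V → Set
  HeadLeast _<_ []      = ⊥
  HeadLeast _<_ (v ∷ b) = All (v <_) b

  canonical-headLeast : {_<_ : V → V → Set} → ∀ {A cs} → AllPairs _<_ A → Canonical A cs → All (HeadLeast _<_) cs
  canonical-headLeast []       []            = []
  canonical-headLeast (h ∷ hs) (add i b↭p c) =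
    Permₚ.All-resp-↭ (↭-sym b↭p) (proj₁ (interleaving-All i h))
    ∷ canonical-headLeast (proj₂ (interleaving-AllPairs i hs)) c

  -- Meant for `f` the orbit and `Q` the test `isRep`: among the letters of a cycle `Q` accepts just
  -- the head, and `f` rebuilds the cycle from it.
  Recovers : (V → List V) → (V → Bool) → List V → Set
  Recovers f Q []      = ⊥
  Recovers f Q (v ∷ b) = Q v ≡ true × All (λ u → Q u ≡ false) b × f v ≡ v ∷ b

  filter-interleaving : ∀ (Q : V → Bool) {p q A} → Interleaving p q A → All (λ u → Q u ≡ false) p →
                        L.filterᵇ Q A ≡ L.filterᵇ Q q
  filter-interleaving Q []                  []       = ≡.refl
  filter-interleaving Q (consˡ i)           (h ∷ hs) rewrite h = filter-interleaving Q i hs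
  filter-interleaving Q {q = x ∷ _} (consʳ i) hs with Q x
  ... | true  = ≡.cong (x ∷_) (filter-interleaving Q i hs)
  ... | false = filter-interleaving Q i hs

  -- Filtering keeps the order of `A`, and canonical cycles are listed in the order of their heads
  -- in `A`. This is why the result is an equality of lists and not merely a rearrangement.
  canonical-recover : ∀ f Q {A cs} → Canonical A cs → All (Recovers f Q) cs → L.map f (L.filterᵇ Q A) ≡ cs
  canonical-recover f Q []            []                   = ≡.refl
  canonical-recover f Q (add i b↭p c) ((Qv , Qb , fv) ∷ h) rewrite Qv =
    ≡.cong₂ _∷_ fv (≡.trans (≡.cong (L.map f) (filter-interleaving Q i (Permₚ.All-resp-↭ b↭p Qb)))
                            (canonical-recover f Q c h))

-- The permutation with given cycles

arcs-source : {V : Set} (x : V) (w : List V) (z : V) → L.map proj₁ (arcs x w z) ≡ x ∷ w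
arcs-source x []      z = ≡.refl
arcs-source x (y ∷ w) z = ≡.cong (x ∷_) (arcs-source y w z)

arcs-target : {V : Set} (x : V) (w : List V) (z : V) → L.map proj₂ (arcs x w z) ≡ w ++ z ∷ []
arcs-target x []      z = ≡.refl
arcs-target x (y ∷ w) z = ≡.cong (y ∷_) (arcs-target y w z)

arcs-++ : {V : Set} (x : V) (w : List V) (y : V) (w′ : List V) (z : V) →
          arcs x (w ++ y ∷ w′) z ≡ arcs x w y ++ arcs y w′ z
arcs-++ x []      y w′ z = ≡.refl
arcs-++ x (u ∷ w) y w′ z = ≡.cong ((x , u) ∷_) (arcs-++ u w y w′ z)

zip-arcs : {V : Set} (x : V) (w : List V) (z : V) → L.zip (x ∷ w) (w ++ z ∷ []) ≡ arcs x w z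
zip-arcs x []      z = ≡.refl
zip-arcs x (y ∷ w) z = ≡.cong ((x , y) ∷_) (zip-arcs y w z)

cycleArcs : {V : Set} → List V → List (V × V)
cycleArcs []      = []
cycleArcs (v ∷ b) = arcs v b v

cycleArcs-source : {V : Set} (cs : List (List V)) → L.map proj₁ (L.concatMap cycleArcs cs) ≡ L.concat cs
cycleArcs-source []             = ≡.refl
cycleArcs-source ([] ∷ cs)      = cycleArcs-source cs
cycleArcs-source ((v ∷ b) ∷ cs) = ≡.trans (LP.map-++ proj₁ (arcs v b v) _)
  (≡.cong₂ _++_ (arcs-source v b v) (cycleArcs-source cs))

-- The targets of a closed cycle are its letters rotated by one place. Through this, `table-unique`
-- finds an arc into every element.
cycleArcs-target : {V : Set} (cs : List (List V)) → L.map proj₂ (L.concatMap cycleArcs cs) ↭ L.concat cs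
cycleArcs-target []             = ↭-refl
cycleArcs-target ([] ∷ cs)      = cycleArcs-target cs
cycleArcs-target ((v ∷ b) ∷ cs) = ↭-trans (↭-reflexive (LP.map-++ proj₂ (arcs v b v) _))
  (Permₚ.++⁺ (↭-trans (↭-reflexive (arcs-target v b v)) (Permₚ.++-comm b (v ∷ []))) (cycleArcs-target cs))

⌊⌋-true : {P : Set} (P? : Dec P) → P → ⌊ P? ⌋ ≡ true
⌊⌋-true (yes _) p = ≡.refl
⌊⌋-true (no ¬p) p = contradiction p ¬p

⌊⌋-false : {P : Set} (P? : Dec P) → ¬ P → ⌊ P? ⌋ ≡ false
⌊⌋-false (yes p) ¬p = contradiction p ¬p
⌊⌋-false (no _)  ¬p = ≡.refl

headOr-filter : {A : Set} (d : A) (Q : A → Bool) (f : ℕ → A) {k m : ℕ} → k ℕ.< m →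
                (∀ {j} → j ℕ.< k → Q (f j) ≡ false) → Q (f k) ≡ true →
                headOr d (L.filterᵇ Q (L.applyUpTo f m)) ≡ f k
headOr-filter d Q f {zero}  {suc m} _         _ h rewrite h = ≡.refl
headOr-filter d Q f {suc k} {suc m} (ℕ.s≤s l) g h rewrite g {0} ℕ.z<s =
  headOr-filter d Q (f ∘ suc) l (λ j<k → g (ℕ.s≤s j<k)) h

all-true : {A : Set} (Q : A → Bool) {w : List A} → All (λ x → Q x ≡ true) w → all Q w ≡ true
all-true Q []       = ≡.refl
all-true Q (h ∷ hs) rewrite h = all-true Q hs

all-false : {A : Set} (Q : A → Bool) {x : A} {w : List A} → x ∈ w → Q x ≡ false → all Q w ≡ false
all-false Q (here ≡.refl)         h rewrite h = ≡.refl
all-false Q {w = y ∷ w} (there p) h with Q y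
... | true  = all-false Q p h
... | false = ≡.refl

unique-++⁻ : {A : Set} (xs : List A) {ys : List A} → Unique (xs ++ ys) → Unique xs × Unique ys
unique-++⁻ []       u       = [] , u
unique-++⁻ (x ∷ xs) (h ∷ u) = let v , w = unique-++⁻ xs u in AllP.++⁻ˡ xs h ∷ v , w

module _ {n : ℕ} where

  -- The default, fixing `i`, concerns letters that are the source of no arc; the arcs of a
  -- canonical partition of `L.allFin n` leave no such letter.
  follow : List (Fin n × Fin n) → Fin n → Fin n
  follow []             i = i
  follow ((x , y) ∷ as) i = if ⌊ i F.≟ x ⌋ then y else follow as i

  Along : (Fin n → Fin n) → Fin n × Fin n → Set
  Along σ (x , y) = σ x ≡ y

  follow-along : ∀ as → Unique (L.map proj₁ as) → All (Along (follow as)) as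
  follow-along []             _       = []
  follow-along ((x , y) ∷ as) (h ∷ u) = here-case ∷ All.tabulate there-case
    where
    here-case : Along (follow ((x , y) ∷ as)) (x , y)
    here-case with x F.≟ x
    ... | yes _  = ≡.refl
    ... | no x≢x = contradiction ≡.refl x≢x
    there-case : ∀ {a} → a ∈ as → Along (follow ((x , y) ∷ as)) a
    there-case {x′ , y′} a∈ with x′ F.≟ x
    ... | yes ≡.refl = contradiction ≡.refl (All.lookup h (∈-map⁺ proj₁ a∈))
    ... | no _       = All.lookup (follow-along as u) a∈

  module _ (σ : Fin n → Fin n) where

    σpow-sucʳ : ∀ k x → σpow σ (suc k) x ≡ σpow σ k (σ x)
    σpow-sucʳ zero    x = ≡.refl
    σpow-sucʳ (suc k) x = ≡.cong σ (σpow-sucʳ k x)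

    σpow-along : ∀ {x w z} → All (Along σ) (arcs x w z) →
                 L.applyUpTo (λ j → σpow σ j x) (suc (L.length w)) ≡ x ∷ w
    σpow-along {w = []}    _ = ≡.refl
    σpow-along {x} {y ∷ w} (≡.refl ∷ h) = ≡.cong (x ∷_)
      (≡.trans (≡.sym (LP.map-upTo _ m)) (≡.trans (LP.map-cong (λ k → σpow-sucʳ k x) (L.upTo m))
        (≡.trans (LP.map-upTo _ m) (σpow-along h))))
      where
      m : ℕ
      m = suc (L.length w)

    σpow-along-end : ∀ {x w z} → All (Along σ) (arcs x w z) → σpow σ (suc (L.length w)) x ≡ z
    σpow-along-end {w = []}    (h ∷ [])     = h
    σpow-along-end {x} {y ∷ w} (≡.refl ∷ h) = ≡.trans (σpow-sucʳ (suc (L.length w)) x) (σpow-along-end h)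

    σpow-along-∈ : ∀ {x w z} → All (Along σ) (arcs x w z) → ∀ {j} → j ℕ.< L.length w → σpow σ (suc j) x ∈ w
    σpow-along-∈ {w = y ∷ w}     (≡.refl ∷ h) {zero}  _         = here ≡.refl
    σpow-along-∈ {x} {w = y ∷ w} (≡.refl ∷ h) {suc j} (ℕ.s≤s l) =
      ≡.subst (_∈ y ∷ w) (≡.sym (σpow-sucʳ (suc j) x)) (there (σpow-along-∈ h l))

    retLen-cycle : ∀ {v b} → Unique (v ∷ b) → All (Along σ) (arcs v b v) → retLen σ v ≡ suc (L.length b)
    retLen-cycle {v} {b} (v∉b ∷ u) h
      rewrite LP.map-upTo suc n = headOr-filter n (λ k → ⌊ σpow σ k v F.≟ v ⌋) suc {m = n}
        -- `retLen` tries the exponents 1 to `n` only, so the length of the cycle must not exceed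
        -- `n`; its letters are distinct elements of `Fin n`.
        (≡.subst (suc (L.length b) ℕ.≤_) (LP.length-tabulate {n = n} id)
          (unique-⊆-length (v∉b ∷ u) (λ _ → ∈-allFin _)))
        -- No earlier return: the smaller powers stay inside `b`, which avoids `v`.
        (λ j<k → ⌊⌋-false (_ F.≟ _) (λ eq → All.lookup v∉b (σpow-along-∈ h j<k) (≡.sym eq)))
        (⌊⌋-true (_ F.≟ _) (σpow-along-end h))

    orbit-cycle : ∀ {v b} → Unique (v ∷ b) → All (Along σ) (arcs v b v) → orbit σ v ≡ v ∷ b
    orbit-cycle {v} {b} u h rewrite retLen-cycle u h =
      ≡.trans (LP.map-upTo (λ j → σpow σ j v) (suc (L.length b))) (σpow-along h)

    isRep-head : ∀ {v b} → Unique (v ∷ b) → All (Along σ) (arcs v b v) → All (v F.<_) b → isRep σ v ≡ true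
    isRep-head {v} u h v<b rewrite orbit-cycle u h =
      all-true _ (⌊⌋-true (v F.≤? v) ℕₚ.≤-refl ∷ All.map (λ {x} v<x → ⌊⌋-true (v F.≤? x) (ℕₚ.<⇒≤ v<x)) v<b)

    -- Rotating the cycle so that it starts at `x` computes the orbit of `x`; this orbit contains
    -- `v`, which is smaller than `x`.
    isRep-tail : ∀ {v b} → Unique (v ∷ b) → All (Along σ) (arcs v b v) → All (v F.<_) b →
                 ∀ {x} → x ∈ b → isRep σ x ≡ false
    isRep-tail {v} u h v<b {x} x∈b with ∈-∃++ x∈b
    ... | as , bs , ≡.refl = ≡.subst (λ γ → all (λ y → ⌊ x F.≤? y ⌋) γ ≡ false) (≡.sym (orbit-cycle u′ h′))
      (all-false _ (there (∈-++⁺ʳ bs (here ≡.refl))) (⌊⌋-false (x F.≤? v) (ℕₚ.<⇒≱ (All.lookup v<b x∈b))))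
      where
      h₂ : All (Along σ) (arcs v as x) × All (Along σ) (arcs x bs v)
      h₂ = AllP.++⁻ (arcs v as x) (≡.subst (All (Along σ)) (arcs-++ v as x bs v) h)
      h′ : All (Along σ) (arcs x (bs ++ v ∷ as) x)
      h′ = ≡.subst (All (Along σ)) (≡.sym (arcs-++ x bs v as x)) (AllP.++⁺ (proj₂ h₂) (proj₁ h₂))
      u′ : Unique (x ∷ bs ++ v ∷ as)
      u′ = Unique-resp-↭ (Permₚ.++-comm (v ∷ as) (x ∷ bs)) u

    cycles-canonical : ∀ {cs} → Canonical (L.allFin n) cs → All (Along σ) (L.concatMap cycleArcs cs) →
                       cycles σ ≡ cs
    cycles-canonical {cs} c h = canonical-recover (orbit σ) (isRep σ) c
      (recovers cs (canonical-headLeast (AllPairsP.tabulate⁺-< id) c) 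
        (Unique-resp-↭ (↭-sym (canonical-concat c)) (Uniqueₚ.allFin⁺ n)) h)
      where
      recovers : ∀ cs → All (HeadLeast F._<_) cs → Unique (L.concat cs) →
                 All (Along σ) (L.concatMap cycleArcs cs) → All (Recovers (orbit σ) (isRep σ)) cs
      recovers []             _              _ _ = []
      recovers ((v ∷ b) ∷ cs) (v<b ∷ hl) u al =
        (isRep-head uγ aγ v<b , All.tabulate (isRep-tail uγ aγ v<b) , orbit-cycle uγ aγ)
        ∷ recovers cs hl (proj₂ (unique-++⁻ (v ∷ b) u)) (proj₂ (AllP.++⁻ (arcs v b v) al))
        where
        uγ : Unique (v ∷ b)
        uγ = proj₁ (unique-++⁻ (v ∷ b) u)
        aγ : All (Along σ) (arcs v b v)
        aγ = proj₁ (AllP.++⁻ (arcs v b v) al)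

  table : List (List (Fin n)) → Vec (Fin n) n
  table cs = V.tabulate (follow (L.concatMap cycleArcs cs))

  module _ {cs : List (List (Fin n))} (c : Canonical (L.allFin n) cs) where

    table-along : All (Along (V.lookup (table cs))) (L.concatMap cycleArcs cs)
    table-along = All.map (λ {(x , _)} h → ≡.trans (VP.lookup∘tabulate _ x) h)
      (follow-along (L.concatMap cycleArcs cs) (≡.subst Unique (≡.sym (cycleArcs-source cs))
        (Unique-resp-↭ (↭-sym (canonical-concat c)) (Uniqueₚ.allFin⁺ n))))

    cycles-table : cycles (V.lookup (table cs)) ≡ cs
    cycles-table = cycles-canonical (V.lookup (table cs)) c table-along

    -- Obtained from surjectivity: every element is the target of an arc and so occurs in the table,
    -- and a list of length `n` containing all `n` elements has no room for a repetition.
    table-unique : Unique (V.toList (table cs))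
    table-unique = Unique-resp-↭ (unique-⊆-↭ (Uniqueₚ.allFin⁺ n) (λ {y} _ → hit y)
      (ℕₚ.≤-reflexive (≡.trans (VP.length-toList (table cs)) (≡.sym (LP.length-tabulate id)))))
      (Uniqueₚ.allFin⁺ n)
      where
      hit : ∀ y → y ∈ V.toList (table cs)
      hit y with ∈-map⁻ proj₂ {xs = L.concatMap cycleArcs cs} (Permₚ.∈-resp-↭
        (↭-sym (↭-trans (cycleArcs-target cs) (canonical-concat c))) (∈-allFin y))
      ... | (x , _) , a∈ , ≡.refl = ≡.subst (_∈ V.toList (table cs)) (All.lookup table-along a∈)
        (V∈.∈-toList⁺ (V∈.∈-lookup x (table cs)))

-- `cycles-table` gives a left inverse of `table`, hence injectivity; `length-cyclePartitions`
-- provides the equality of lengths that makes the injection exhaust the listings.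
cyclePartitions-↭-listings : ∀ n → L.map table (cyclePartitions (L.length (L.allFin n)) (L.allFin n)) ↭ listings n
cyclePartitions-↭-listings n = unique-⊆-↭ tables-unique to
  (ℕₚ.≤-reflexive (≡.trans (≡.sym (LP.length-map V.toList (listings n)))
    (≡.trans (Permₚ.↭-length (listings-↭-arrangements n))
      (≡.trans (≡.sym (length-cyclePartitions (L.allFin n))) (≡.sym (LP.length-map table CP))))))
  where
  CP : List (List (List (Fin n)))
  CP = cyclePartitions (L.length (L.allFin n)) (L.allFin n)
  canonical : ∀ {cs} → cs ∈ CP → Canonical (L.allFin n) cs
  canonical = ∈-cyclePartitions⁻ (L.length (L.allFin n)) (L.allFin n)
  tables-unique : Unique (L.map table CP)
  tables-unique = go (λ cs∈ → cs∈) (cyclePartitions-unique (L.length (L.allFin n)) (Uniqueₚ.allFin⁺ n))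
    where
    -- Rotating a cycle does not change the table, so `table` is injective only on canonical
    -- partitions; membership in `CP` is therefore carried along.
    go : ∀ {css} → (∀ {cs} → cs ∈ css → cs ∈ CP) → Unique css → Unique (L.map table css)
    go sub []      = []
    go sub (h ∷ u) = AllP.map⁺ (All.tabulate (λ {ds} ds∈ eq → All.lookup h ds∈
      (≡.trans (≡.sym (cycles-table (canonical (sub (here ≡.refl)))))
        (≡.trans (≡.cong (cycles ∘ V.lookup) eq) (cycles-table (canonical (sub (there ds∈))))))))
      ∷ go (sub ∘ there) u
  to : ∀ {w} → w ∈ L.map table CP → w ∈ listings n
  to w∈ with ∈-map⁻ table w∈
  ... | cs , cs∈ , ≡.refl = ∈-listings⁺ (table cs) (table-unique (canonical cs∈))

-- Expansion in monomials

vec-ext : {A : Set} {m : ℕ} {u v : Vec A m} → (∀ i → V.lookup u i ≡ V.lookup v i) → u ≡ v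
vec-ext {u = u} {v} h = ≡.trans (≡.sym (VP.tabulate∘lookup u)) (≡.trans (VP.tabulate-cong h) (VP.tabulate∘lookup v))

unit : ∀ {N} → ℕ → Fin N → Vec ℕ N
unit m j = V.tabulate (λ j′ → if ⌊ j F.≟ j′ ⌋ then m else 0)

unit-zero : ∀ {N} (j : Fin N) → unit 0 j ≡ V.replicate N 0
unit-zero {N} j = vec-ext λ i → ≡.trans (VP.lookup∘tabulate _ i) (≡.trans (same ⌊ j F.≟ i ⌋) (≡.sym (VP.lookup-replicate i 0)))
  where
  same : ∀ b → (if b then 0 else 0) ≡ 0
  same true  = ≡.refl
  same false = ≡.refl

unit-suc : ∀ {N} m (j : Fin N) → unit (suc m) j ≡ V.zipWith ℕ._+_ (unit 1 j) (unit m j)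
unit-suc m j = vec-ext λ i → ≡.trans (VP.lookup∘tabulate _ i) (≡.trans (split ⌊ j F.≟ i ⌋) (≡.sym
  (≡.trans (VP.lookup-zipWith ℕ._+_ i (unit 1 j) (unit m j))
    (≡.cong₂ ℕ._+_ (VP.lookup∘tabulate _ i) (VP.lookup∘tabulate _ i)))))
  where
  split : ∀ b → (if b then suc m else 0) ≡ (if b then 1 else 0) ℕ.+ (if b then m else 0)
  split true  = ≡.refl
  split false = ≡.refl

expo-[] : ∀ {N} → expo {N} [] ≡ V.replicate N 0
expo-[] {N} = vec-ext λ i → ≡.trans (VP.lookup∘tabulate (λ _ → 0) i) (≡.sym (VP.lookup-replicate i 0))

expo-∷ : ∀ {N m} (j : Fin N) (i : Vec (Fin N) m) → expo (j ∷ i) ≡ V.zipWith ℕ._+_ (unit 1 j) (expo i)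
expo-∷ {N} j i = vec-ext λ k → ≡.trans (VP.lookup∘tabulate _ k) (≡.trans (count k) (≡.sym
  (≡.trans (VP.lookup-zipWith ℕ._+_ k (unit 1 j) (expo i))
    (≡.cong₂ ℕ._+_ (VP.lookup∘tabulate _ k) (VP.lookup∘tabulate _ k)))))
  where
  count : ∀ k → L.length (L.filterᵇ (λ x → ⌊ x F.≟ k ⌋) (V.toList (j ∷ i)))
              ≡ (if ⌊ j F.≟ k ⌋ then 1 else 0) ℕ.+ L.length (L.filterᵇ (λ x → ⌊ x F.≟ k ⌋) (V.toList i))
  count k with ⌊ j F.≟ k ⌋
  ... | true  = ≡.refl
  ... | false = ≡.refl

allPairs-split : {A : Set} {_∼_ : A → A → Set} (ys : List A) {x : A} {zs : List A} →
                 AllPairs _∼_ (ys ++ x ∷ zs) → All (_∼ x) ys × All (x ∼_) zs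
allPairs-split []       (h ∷ _)  = [] , h
allPairs-split (y ∷ ys) (h ∷ hs) = let l , r = allPairs-split ys hs in
  All.lookup h (∈-++⁺ʳ ys (here ≡.refl)) ∷ l , r

module Expansion {c ℓ : Level} (R : CommutativeRing c ℓ) (n : ℕ)
                 (t : Fin n → Fin n → CommutativeRing.Carrier R) (N : ℕ) where
  open CommutativeRing R using (Carrier; _≈_; _+_; _*_; _-_; -_; 0#; 1#)
  module R = CommutativeRing R
  open Polynomials R
  module S = CommutativeRing (polyRing N)
  open Sums S.commutativeSemiring
  open Exp S.semiring using (_^_)
  open import Relation.Binary.Reasoning.Setoid S.setoid

  ι : Carrier → Poly R N
  ι a = a ⊡ 𝟙

  ⊡-cong : ∀ {a b} {f g : Poly R N} → a ≈ b → f ≐ g → a ⊡ f ≐ b ⊡ g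
  ⊡-cong p q α = R.*-cong p (q α)

  ι-⊛ : ∀ a f → ι a ⊛ f ≐ a ⊡ f
  ι-⊛ a f = S.trans (⊛-⊡ a 𝟙 f) (⊡-cong R.refl (⊛-identityˡ f))

  ι-* : ∀ a b → ι (a * b) ≐ ι a ⊛ ι b
  ι-* a b = S.sym (S.trans (ι-⊛ a (ι b)) (λ α → R.sym (R.*-assoc a b _)))

  ι-+ : ∀ a b → ι (a + b) ≐ ι a ⊞ ι b
  ι-+ a b α = R.distribʳ _ a b

  ι-neg : ∀ a → ι (- a) ≐ S.- ι a
  ι-neg a α = R.sym (RingProperties.-‿distribˡ-* R.ring a _)

  ι-1 : ι 1# ≐ 𝟙
  ι-1 α = R.*-identityˡ _

  ι-∏ : {A : Set} (f : A → Carrier) (g : A → Poly R N) → (∀ x → ι (f x) ≐ g x) →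
        ∀ xs → ι (prodR R (L.map f xs)) ≐ ∏ xs g
  ι-∏ f g h []       = ι-1
  ι-∏ f g h (x ∷ xs) = S.trans (ι-* (f x) (prodR R (L.map f xs))) (S.*-cong (h x) (ι-∏ f g h xs))

  ⊡-⊛-⊡ : ∀ a b f g → (a * b) ⊡ (f ⊛ g) ≐ (a ⊡ f) ⊛ (b ⊡ g)
  ⊡-⊛-⊡ a b f g = begin
    (a * b) ⊡ (f ⊛ g)          ≈⟨ (λ α → R.*-assoc a b _) ⟩
    a ⊡ (b ⊡ (f ⊛ g))          ≈⟨ ⊡-cong R.refl (⊡-cong R.refl (⊛-comm f g)) ⟩
    a ⊡ (b ⊡ (g ⊛ f))          ≈⟨ ⊡-cong R.refl (⊛-⊡ b g f) ⟨
    a ⊡ ((b ⊡ g) ⊛ f)          ≈⟨ ⊡-cong R.refl (⊛-comm (b ⊡ g) f) ⟩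
    a ⊡ (f ⊛ (b ⊡ g))          ≈⟨ ⊛-⊡ a f (b ⊡ g) ⟨
    (a ⊡ f) ⊛ (b ⊡ g)          ∎

  X : Fin N → Poly R N
  X j = mono R (unit 1 j)

  open PathCycle (polyRing N) (λ x y → ι (t x y))
  open Palette X
  open Species S.commutativeSemiring (Fin n) using (_⋆_; ⋆-⊡ˡ)

  mono-cong : ∀ {α β : Vec ℕ N} → α ≡ β → mono R α ≐ mono R β
  mono-cong ≡.refl γ = R.refl

  mono-unit : ∀ j m → mono R (unit m j) ≐ X j ^ m
  mono-unit j zero    = mono-cong (unit-zero j)
  mono-unit j (suc m) = begin
    mono R (unit (suc m) j)                               ≈⟨ mono-cong (unit-suc m j) ⟩
    mono R (V.zipWith ℕ._+_ (unit 1 j) (unit m j))        ≈⟨ mono-⊛-mono (unit 1 j) (unit m j) ⟨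
    X j ⊛ mono R (unit m j)                               ≈⟨ ⊛-congˡ (X j) (mono-unit j m) ⟩
    X j ⊛ X j ^ m                                         ∎

  pw-powerSum : ∀ m → pw R N m ≐ powerSum (L.allFin N) m
  pw-powerSum m = ∑-cong (L.allFin N) (λ j → mono-unit j m)

  ι-t⁺ : ∀ x y → ι (t x y + 1#) ≐ t⁺ x y
  ι-t⁺ x y = S.trans (ι-+ (t x y) 1#) (S.+-congˡ {ι (t x y)} ι-1)

  cycFactor-cycleWeight : ∀ γ → ι (cycFactor R n t γ) ≐ cycleWeight γ
  cycFactor-cycleWeight []      = λ α → R.trans (R.*-congʳ (R.-‿inverseʳ 1#)) (R.zeroˡ _)
  cycFactor-cycleWeight (v ∷ w) = S.trans (ι-+ _ (- _)) (S.+-cong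
    (S.trans (ι-∏ _ _ (λ (x , y) → ι-t⁺ x y) (CArcs (v ∷ w))) (S.reflexive (≡.cong (λ as → ∏ as _) (zip-arcs v w v))))
    (S.trans (ι-neg _) (S.-‿cong
      (S.trans (ι-∏ _ _ (λ (x , y) → S.refl) (CArcs (v ∷ w))) (S.reflexive (≡.cong (λ as → ∏ as _) (zip-arcs v w v)))))))

  cycleProduct : List (List (Fin n)) → Poly R N
  cycleProduct cs = prodR R (L.map (cycFactor R n t) cs) ⊡ pλ R N (L.map L.length cs)

  cycleProduct-∏ : ∀ cs → cycleProduct cs ≐ ∏ cs (cycleTerms (L.allFin N))
  cycleProduct-∏ []       = ι-1
  cycleProduct-∏ (γ ∷ cs) = begin
    cycleProduct (γ ∷ cs)
      ≈⟨ ⊡-⊛-⊡ (cycFactor R n t γ) (prodR R (L.map (cycFactor R n t) cs)) (pw R N (L.length γ)) (pλ R N (L.map L.length cs)) ⟩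
    (cycFactor R n t γ ⊡ pw R N (L.length γ)) ⊛ cycleProduct cs
      ≈⟨ ⊛-cong (S.trans (S.sym (ι-⊛ (cycFactor R n t γ) (pw R N (L.length γ))))
           (⊛-cong (cycFactor-cycleWeight γ) (pw-powerSum (L.length γ)))) (cycleProduct-∏ cs) ⟩
    ∏ (γ ∷ cs) (cycleTerms (L.allFin N)) ∎

  RHS-cyclePartitions : RHS R n t N ≐
    ∑ (cyclePartitions (L.length (L.allFin n)) (L.allFin n)) (λ cs → ∏ cs (cycleTerms (L.allFin N)))
  RHS-cyclePartitions = begin
    ∑ (L.map V.lookup (listings n)) (cycleProduct ∘ cycles)
      ≈⟨ ∑-map V.lookup (listings n) (cycleProduct ∘ cycles) ⟩
    ∑ (listings n) (cycleProduct ∘ cycles ∘ V.lookup)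
      ≈⟨ ∑-↭ (cycleProduct ∘ cycles ∘ V.lookup) (cyclePartitions-↭-listings n) ⟨
    ∑ (L.map table CP) (cycleProduct ∘ cycles ∘ V.lookup)
      ≈⟨ ∑-map table CP (cycleProduct ∘ cycles ∘ V.lookup) ⟩
    ∑ CP (cycleProduct ∘ cycles ∘ V.lookup ∘ table)
      ≈⟨ ∑-cong-∈ CP (λ {cs} cs∈ → S.trans
           (S.reflexive (≡.cong cycleProduct (cycles-table (∈-cyclePartitions⁻ (L.length (L.allFin n)) (L.allFin n) cs∈))))
           (cycleProduct-∏ cs)) ⟩
    ∑ CP (λ cs → ∏ cs (cycleTerms (L.allFin N))) ∎
    where
    CP : List (List (List (Fin n)))
    CP = cyclePartitions (L.length (L.allFin n)) (L.allFin n)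

  -- Summation over weakly increasing colourings.

  Colouring : ℕ → Set
  Colouring = Vec (Fin N)

  colourings : (m : ℕ) → List (Colouring m)
  colourings = allVecs (L.allFin N)

  term : ∀ {m} → Vec (Fin n) m → Colouring m → Poly R N
  term w i = adjProd R n t w i ⊡ mono R (expo i)

  -- Zero summands replace the filter by `weakInc`, so that sums run over all colourings and can be
  -- taken one letter at a time.
  guard : Bool → Poly R N → Poly R N
  guard b f = if b then f else 𝟘

  -- The sum over the colourings of w that may follow a letter x of colour j, including the
  -- weight of the arc leaving x but not the variable of x.
  tail : ∀ {m} → Fin N → Fin n → Vec (Fin n) m → Poly R N
  tail {m} j x w = ∑ (colourings m) (λ i → guard (weakInc (j ∷ i)) (adjProd R n t (x ∷ w) (j ∷ i) ⊡ mono R (expo i)))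

  guard-cong : ∀ b {f g} → f ≐ g → guard b f ≐ guard b g
  guard-cong true  p = p
  guard-cong false p = S.refl

  guard-⊛ : ∀ b e f → guard b (e ⊛ f) ≐ e ⊛ guard b f
  guard-⊛ true  e f = S.refl
  guard-⊛ false e f = S.sym (S.zeroʳ e)

  ⊡-mono-∷ : ∀ {m} a k (i : Colouring m) → a ⊡ mono R (expo (k ∷ i)) ≐ X k ⊛ (a ⊡ mono R (expo i))
  ⊡-mono-∷ a k i = begin
    a ⊡ mono R (expo (k ∷ i))             ≈⟨ ⊡-cong R.refl (S.trans (mono-cong (expo-∷ k i)) (S.sym (mono-⊛-mono (unit 1 k) (expo i)))) ⟩
    a ⊡ (X k ⊛ mono R (expo i))           ≈⟨ ⊡-cong R.refl (⊛-comm (X k) (mono R (expo i))) ⟩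
    a ⊡ (mono R (expo i) ⊛ X k)           ≈⟨ ⊛-⊡ a (mono R (expo i)) (X k) ⟨
    (a ⊡ mono R (expo i)) ⊛ X k           ≈⟨ ⊛-comm (a ⊡ mono R (expo i)) (X k) ⟩
    X k ⊛ (a ⊡ mono R (expo i))           ∎

  link : Fin N → Fin N → Fin n → Fin n → Carrier
  link j k x y = if ⌊ j F.≟ k ⌋ then t x y + 1# else 1#

  guard-∧ : ∀ a b f → guard (a ∧ b) f ≐ guard a (guard b f)
  guard-∧ true  b f = S.refl
  guard-∧ false b f = S.refl

  ∑-guard : ∀ b {m} (f : Colouring m → Poly R N) → ∑ (colourings m) (λ i → guard b (f i)) ≐ guard b (∑ (colourings m) f)
  ∑-guard true  f = S.refl
  ∑-guard false {m} f = ∑-zero (colourings m) (λ _ → S.refl)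

  term-∷ : ∀ {m} k y (w : Vec (Fin n) m) →
    ∑ (colourings m) (λ i → guard (weakInc (k ∷ i)) (term (y ∷ w) (k ∷ i))) ≐ X k ⊛ tail k y w
  term-∷ {m} k y w = S.trans (∑-cong (colourings m) (λ i →
      S.trans (guard-cong (weakInc (k ∷ i)) (⊡-mono-∷ (adjProd R n t (y ∷ w) (k ∷ i)) k i))
              (guard-⊛ (weakInc (k ∷ i)) (X k) (adjProd R n t (y ∷ w) (k ∷ i) ⊡ mono R (expo i)))))
    (∑-*ˡ (X k) (colourings m) (λ i → guard (weakInc (k ∷ i)) (adjProd R n t (y ∷ w) (k ∷ i) ⊡ mono R (expo i))))

  tail-∷ : ∀ {m} j x y (w : Vec (Fin n) m) →
    tail j x (y ∷ w) ≐ ∑ (L.allFin N) (λ k → guard ⌊ j F.≤? k ⌋ (ι (link j k x y) ⊛ (X k ⊛ tail k y w)))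
  tail-∷ {m} j x y w = S.trans
    (∑-concatMap-map _∷_ (λ _ → colourings m) (L.allFin N)
      (λ i → guard (weakInc (j ∷ i)) (adjProd R n t (x ∷ y ∷ w) (j ∷ i) ⊡ mono R (expo i))))
    (∑-cong (L.allFin N) λ k → begin
      ∑ (colourings m) (λ i → guard (⌊ j F.≤? k ⌋ ∧ weakInc (k ∷ i)) ((link j k x y * adj k i) ⊡ mono R (expo (k ∷ i))))
        ≈⟨ ∑-cong (colourings m) (λ i → S.trans
             (guard-∧ ⌊ j F.≤? k ⌋ (weakInc (k ∷ i)) ((link j k x y * adj k i) ⊡ mono R (expo (k ∷ i))))
             (guard-cong ⌊ j F.≤? k ⌋ (S.trans
               (guard-cong (weakInc (k ∷ i)) (S.trans (λ α → R.*-assoc _ _ _) (S.sym (ι-⊛ (link j k x y) (term (y ∷ w) (k ∷ i))))))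
               (guard-⊛ (weakInc (k ∷ i)) (ι (link j k x y)) (term (y ∷ w) (k ∷ i)))))) ⟩
      ∑ (colourings m) (λ i → guard ⌊ j F.≤? k ⌋ (ι (link j k x y) ⊛ guard (weakInc (k ∷ i)) (term (y ∷ w) (k ∷ i))))
        ≈⟨ ∑-guard ⌊ j F.≤? k ⌋ (λ i → ι (link j k x y) ⊛ guard (weakInc (k ∷ i)) (term (y ∷ w) (k ∷ i))) ⟩
      guard ⌊ j F.≤? k ⌋ (∑ (colourings m) (λ i → ι (link j k x y) ⊛ guard (weakInc (k ∷ i)) (term (y ∷ w) (k ∷ i))))
        ≈⟨ guard-cong ⌊ j F.≤? k ⌋ (S.trans
             (∑-*ˡ (ι (link j k x y)) (colourings m) (λ i → guard (weakInc (k ∷ i)) (term (y ∷ w) (k ∷ i))))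
             (⊛-congˡ (ι (link j k x y)) (term-∷ k y w))) ⟩
      guard ⌊ j F.≤? k ⌋ (ι (link j k x y) ⊛ (X k ⊛ tail k y w)) ∎)
    where
    adj : Fin N → Colouring m → Carrier
    adj k i = adjProd R n t (y ∷ w) (k ∷ i)

  term-[] : 1# ⊡ mono R (expo []) ⊞ 𝟘 ≐ 𝟙
  term-[] = S.trans (S.+-identityʳ _) (S.trans (λ α → R.*-identityˡ _) (mono-cong expo-[]))

  -- After a letter of colour `j`, the smaller colours `ys` are killed by the guard, `j` itself
  -- continues the current block across an arc of weight `t⁺`, and a larger colour from `js` opens a
  -- new block across an arc of weight 1.
  tail-paths : ∀ {m} ys j js → L.allFin N ≡ ys ++ j ∷ js → ∀ x (w : Vec (Fin n) m) →
               tail j x w ≐ (from (X j) t⁺ x ⋆ paths js) (V.toList w)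
  -- The colour of the first letter is that of the first nonempty block: either the block of the
  -- first colour available is empty, or the word begins in it.
  tails-paths : ∀ {m} ys js → L.allFin N ≡ ys ++ js → ∀ y (w : Vec (Fin n) m) →
                ∑ js (λ k → X k ⊛ tail k y w) ≐ paths js (y ∷ V.toList w)

  tail-paths ys j js eq x []      = S.trans term-[] (S.sym (S.trans (⊛-identityˡ (paths js [])) (paths-[] js)))
  tail-paths ys j js eq x (y ∷ w) = begin
    tail j x (y ∷ w)
      ≈⟨ tail-∷ j x y w ⟩
    ∑ (L.allFin N) summand
      ≈⟨ S.reflexive (≡.cong (λ ks → ∑ ks summand) eq) ⟩
    ∑ (ys ++ j ∷ js) summand
      ≈⟨ ∑-++ ys (j ∷ js) summand ⟩
    ∑ ys summand ⊞ (summand j ⊞ ∑ js summand)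
      ≈⟨ S.+-cong (S.trans (∑-cong-∈ ys below-j) (∑-zero ys (λ _ → S.refl)))
           (S.+-cong at-j (S.trans (∑-cong-∈ js above-j) (tails-paths (ys ++ j ∷ []) js eq′ y w))) ⟩
    𝟘 ⊞ (t⁺ x y ⊛ (X j ⊛ tail j y w) ⊞ paths js (y ∷ V.toList w))
      ≈⟨ S.trans (S.+-identityˡ _) (S.+-comm (t⁺ x y ⊛ (X j ⊛ tail j y w)) (paths js (y ∷ V.toList w))) ⟩
    paths js (y ∷ V.toList w) ⊞ t⁺ x y ⊛ (X j ⊛ tail j y w)
      ≈⟨ S.+-cong (⊛-identityˡ (paths js (y ∷ V.toList w)))
           (S.trans (⋆-⊡ˡ (t⁺ x y) (λ u → X j ⊛ from (X j) t⁺ y u) (paths js) (V.toList w))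
             (⊛-congˡ (t⁺ x y) (S.trans (⋆-⊡ˡ (X j) (from (X j) t⁺ y) (paths js) (V.toList w))
               (⊛-congˡ (X j) (S.sym (tail-paths ys j js eq y w)))))) ⟨
    (from (X j) t⁺ x ⋆ paths js) (y ∷ V.toList w) ∎
    where
    summand : Fin N → Poly R N
    summand k = guard ⌊ j F.≤? k ⌋ (ι (link j k x y) ⊛ (X k ⊛ tail k y w))
    eq′ : L.allFin N ≡ (ys ++ j ∷ []) ++ js
    eq′ = ≡.trans eq (≡.sym (LP.++-assoc ys (j ∷ []) js))
    sorted : All (F._< j) ys × All (j F.<_) js
    sorted = allPairs-split ys (≡.subst (AllPairs F._<_) eq (AllPairsP.tabulate⁺-< id))
    below-j : ∀ {k} → k ∈ ys → summand k ≐ 𝟘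
    below-j {k} k∈ rewrite ⌊⌋-false (j F.≤? k) (ℕₚ.<⇒≱ (All.lookup (proj₁ sorted) k∈)) = S.refl
    at-j : summand j ≐ t⁺ x y ⊛ (X j ⊛ tail j y w)
    at-j rewrite ⌊⌋-true (j F.≤? j) ℕₚ.≤-refl | ⌊⌋-true (j F.≟ j) ≡.refl = ⊛-congʳ (X j ⊛ tail j y w) (ι-t⁺ x y)
    above-j : ∀ {k} → k ∈ js → summand k ≐ X k ⊛ tail k y w
    above-j {k} k∈ rewrite ⌊⌋-true (j F.≤? k) (ℕₚ.<⇒≤ (All.lookup (proj₂ sorted) k∈))
                         | ⌊⌋-false (j F.≟ k) (FP.<⇒≢ (All.lookup (proj₂ sorted) k∈)) =
      S.trans (⊛-congʳ (X k ⊛ tail k y w) ι-1) (⊛-identityˡ (X k ⊛ tail k y w))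

  tails-paths ys []       eq y w = S.refl
  tails-paths ys (k ∷ js) eq y w = begin
    X k ⊛ tail k y w ⊞ ∑ js (λ k → X k ⊛ tail k y w)
      ≈⟨ S.+-cong (⊛-congˡ (X k) (tail-paths ys k js eq y w))
           (tails-paths (ys ++ k ∷ []) js (≡.trans eq (≡.sym (LP.++-assoc ys (k ∷ []) js))) y w) ⟩
    X k ⊛ (from (X k) t⁺ y ⋆ paths js) (V.toList w) ⊞ paths js (y ∷ V.toList w)
      ≈⟨ S.+-comm (X k ⊛ (from (X k) t⁺ y ⋆ paths js) (V.toList w)) (paths js (y ∷ V.toList w)) ⟩
    paths js (y ∷ V.toList w) ⊞ X k ⊛ (from (X k) t⁺ y ⋆ paths js) (V.toList w)
      ≈⟨ S.+-cong (⊛-identityˡ (paths js (y ∷ V.toList w)))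
           (⋆-⊡ˡ (X k) (from (X k) t⁺ y) (paths js) (V.toList w)) ⟨
    paths (k ∷ js) (y ∷ V.toList w) ∎

  ∑-weakInc : ∀ {m} (w : Vec (Fin n) m) →
              ∑ (L.filterᵇ weakInc (colourings m)) (term w) ≐ paths (L.allFin N) (V.toList w)
  ∑-weakInc []      = S.trans term-[] (S.sym (paths-[] (L.allFin N)))
  ∑-weakInc {suc m} (y ∷ w) = begin
    ∑ (L.filterᵇ weakInc (colourings (suc m))) (term (y ∷ w))
      ≈⟨ ∑-filterᵇ weakInc (colourings (suc m)) (term (y ∷ w)) ⟩
    ∑ (colourings (suc m)) (λ i → guard (weakInc i) (term (y ∷ w) i))
      ≈⟨ ∑-concatMap-map _∷_ (λ _ → colourings m) (L.allFin N) (λ i → guard (weakInc i) (term (y ∷ w) i)) ⟩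
    ∑ (L.allFin N) (λ k → ∑ (colourings m) (λ i → guard (weakInc (k ∷ i)) (term (y ∷ w) (k ∷ i))))
      ≈⟨ ∑-cong (L.allFin N) (λ k → term-∷ k y w) ⟩
    ∑ (L.allFin N) (λ k → X k ⊛ tail k y w)
      ≈⟨ tails-paths [] (L.allFin N) ≡.refl y w ⟩
    paths (L.allFin N) (y ∷ V.toList w) ∎

  Ũ-arrangements : Ũ R n t N ≐ ∑ (arrangements (L.allFin n)) (paths (L.allFin N))
  Ũ-arrangements = begin
    Ũ R n t N
      ≈⟨ S.reflexive (≡.cong (sumP R) (LP.map-id terms)) ⟨
    ∑ terms id
      ≈⟨ ∑-concatMap-map term (λ _ → L.filterᵇ weakInc (colourings n)) (listings n) id ⟩
    ∑ (listings n) (λ w → ∑ (L.filterᵇ weakInc (colourings n)) (term w))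
      ≈⟨ ∑-cong (listings n) ∑-weakInc ⟩
    ∑ (listings n) (paths (L.allFin N) ∘ V.toList)
      ≈⟨ ∑-map V.toList (listings n) (paths (L.allFin N)) ⟨
    ∑ (L.map V.toList (listings n)) (paths (L.allFin N))
      ≈⟨ ∑-↭ (paths (L.allFin N)) (listings-↭-arrangements n) ⟩
    ∑ (arrangements (L.allFin n)) (paths (L.allFin N)) ∎
    where
    terms : List (Poly R N)
    terms = L.concatMap (λ w → L.map (term w) (L.filterᵇ weakInc (colourings n))) (listings n)

  Ũ≐RHS : Ũ R n t N ≐ RHS R n t N
  Ũ≐RHS = S.trans Ũ-arrangements (S.trans (∑-paths≈∑-cycles (L.allFin N) (L.allFin n)) (S.sym RHS-cyclePartitions))

theorem9p3 : ∀ {c ℓ} (R : CommutativeRing c ℓ) (n : ℕ)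
    (t : Fin n → Fin n → CommutativeRing.Carrier R) →
    ∀ (N : ℕ) → _≈ₚ_ R (Ũ R n t N) (RHS R n t N)
theorem9p3 R n t N = Expansion.Ũ≐RHS R n t N
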